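{- As formal power series in $q$, $$\sum_{\pi\in\mathcal{G}\mathcal{G}_2} \omega_2(\pi)\, q^{|\pi|} = \sum_{\pi\in\mathcal{P}_{rdo}} q^{|\pi|},$$ where the sets of partitions $\mathcal{G}\mathcal{G}_2$, $\mathcal{P}_{rdo}$ and the weight $\omega_2$ are as defined in the context.
   Context: A partition $\pi=(\lambda_1,\lambda_2,\dots,\lambda_{\nu(\pi)})$ is a finite non-increasing sequence of positive integers (its parts); $\nu(\pi)$ is the number of parts and $|\pi|$ is the sum of the parts. The empty sequence is the unique partition of $0$. In frequency notation $\pi=(1^{f_1},2^{f_2},\dots)$, $f_i$ is the number of occurrences of $i$ as a part of $\pi$. $\mathcal{G}\mathcal{G}_2$ is the set of partitions into parts $\geq 3$ such that the difference between any two consecutive parts is $\geq 2$ and no two consecutive even numbers (i.e. $2k$ and $2k+2$) both appear as parts. Weight: let $\delta_{n,e}=1$ if $n$ is even and $0$ otherwise, and set $\lambda_{\nu(\pi)+1}:=0$ (so $\delta_{\lambda_{\nu(\pi)+1},e}=1$). Then $$\omega_2(\pi):=\prod_{i=1}^{\nu(\pi)} \frac{\lambda_i-\lambda_{i+1}-\delta_{\lambda_i,e}-\delta_{\lambda_{i+1},e}}{2},$$ with the empty product equal to $1$ (weight of the empty partition). $\mathcal{P}_{rdo}$ is the set of partitions in which odd parts are distinct (even parts may repeat), the smallest part is $>1$ (the empty partition is included), and, if the smallest part is $2$, then for some positive integer $j$ the partition $\pi$ starts in one of the following two ways: (1) $\pi=(2^{f_2},4^{f_4},6^{f_6},\dots,(4j-2)^{f_{4j-2}},(4j-1)^1,\dots)$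 with $f_2,f_4,\dots,f_{4j-2}$ all positive; that is, all of $2,4,\dots,4j-2$ occur as parts, $4j-1$ occurs exactly once, and no odd number less than $4j-1$ occurs; or (2) $\pi=(2^{f_2},4^{f_4},6^{f_6},\dots,(4j)^{f_{4j}},(4j+1)^0,(4j+2)^0,\dots)$ with $f_2,f_4,\dots,f_{4j}$ all positive; that is, all of $2,4,\dots,4j$ occur as parts, and neither $4j+2$ nor any odd number $\leq 4j+1$ occurs. -}

module Defs where

open import Data.Empty using (⊥-elim)
open import Data.Integer.Base as ℤ using (ℤ; +_)
open import Data.List.Base using (List; []; _∷_; _++_; map; filter; foldr; last; length)
open import Data.List.Membership.Propositional using (_∈_)
open import Data.List.Membership.Propositional.Properties
  using (∈-map⁺; ∈-map⁻; ∈-++⁺ˡ; ∈-++⁺ʳ; ∈-++⁻; ∈-filter⁺; ∈-filter⁻)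
open import Data.List.Relation.Unary.All as All using (All; []; _∷_)
open import Data.List.Relation.Unary.AllPairs using ([]; _∷_)
open import Data.List.Relation.Unary.Any using (here; there)
open import Data.List.Relation.Unary.Linked using (Linked; linked?)
open import Data.List.Relation.Unary.Unique.Propositional using (Unique)
import Data.List.Relation.Unary.Unique.Propositional.Properties as Unique
import Data.List.Membership.DecPropositional as DecMembership
open import Data.Maybe.Base using (just)
import Data.Maybe.Properties as Maybe
open import Data.Nat.Base using (ℕ; zero; suc; _+_; _*_; _∸_; _≤_; _<_; _≥_; z≤n; s≤s; s≤s⁻¹)
open import Data.Nat.Divisibility using (_∣_; _∣?_)
open import Data.Nat.ListAction using (sum)
open import Data.Nat.Properties
open import Data.Product.Base using (_×_; _,_; ∃)
open import Data.Rational.Base as ℚ using (ℚ; 0ℚ; 1ℚ)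
open import Data.Sum.Base using (_⊎_; inj₁; inj₂)
open import Function.Bundles using (_⇔_; mk⇔)
open import Relation.Binary.PropositionalEquality using (_≡_; refl; sym; cong; subst)
open import Relation.Nullary using (¬_; Dec; yes; no)
open import Relation.Nullary.Decidable using (map′; _×-dec_; _⊎-dec_; _→-dec_; ¬?)
open import Relation.Unary using (Decidable)

open DecMembership _≟_ using (_∈?_)

record IsPartition (π : List ℕ) : Set where
  constructor mkIsPartition
  field
    positive      : All (0 <_) π
    nonIncreasing : Linked _≥_ π

-- The frequency fᵢ of i as a part of π.
freq : ℕ → List ℕ → ℕ
freq i π = length (filter (i ≟_) π)

Even Odd : ℕ → Set
Even n = 2 ∣ n
Odd  n = ¬ Even n

record GG₂ (π : List ℕ) : Set where
  constructor mkGG₂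
  field
    isPartition        : IsPartition π
    partsAtLeast3      : All (3 ≤_) π
    differences        : Linked (λ a b → b + 2 ≤ a) π
    noConsecutiveEvens : ∀ k → ¬ (2 * k ∈ π × 2 * k + 2 ∈ π)

-- π = (2^f₂, 4^f₄, …, (4j-2)^f₄ⱼ₋₂, (4j-1)^1, …) with f₂, f₄, …, f₄ⱼ₋₂ positive.
record Start₁ (π : List ℕ) (j : ℕ) : Set where
  constructor mkStart₁
  field
    evensPresent : ∀ i → 1 ≤ i → i ≤ 2 * j ∸ 1 → 1 ≤ freq (2 * i) π
    oddOnce      : freq (4 * j ∸ 1) π ≡ 1
    noSmallerOdd : ∀ i → Odd i → i < 4 * j ∸ 1 → freq i π ≡ 0

-- π = (2^f₂, 4^f₄, …, (4j)^f₄ⱼ, (4j+1)^0, (4j+2)^0, …) with f₂, f₄, …, f₄ⱼ positive.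
record Start₂ (π : List ℕ) (j : ℕ) : Set where
  constructor mkStart₂
  field
    evensPresent : ∀ i → 1 ≤ i → i ≤ 2 * j → 1 ≤ freq (2 * i) π
    nextEvenGone : freq (4 * j + 2) π ≡ 0
    noSmallOdd   : ∀ i → Odd i → i ≤ 4 * j + 1 → freq i π ≡ 0

-- The smallest part of a nonempty partition is its last entry.
record Prdo (π : List ℕ) : Set where
  constructor mkPrdo
  field
    isPartition      : IsPartition π
    oddPartsDistinct : ∀ i → Odd i → freq i π ≤ 1
    smallestPart>1   : All (1 <_) π
    smallestPart≡2   : last π ≡ just 2 → ∃ λ j → 1 ≤ j × (Start₁ π j ⊎ Start₂ π j)

δₑ : ℕ → ℤ
δₑ n with 2 ∣? n
... | yes _ = + 1
... | no  _ = + 0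

-- The convention λ_{ν(π)+1} = 0.
headOr0 : List ℕ → ℕ
headOr0 []      = 0
headOr0 (x ∷ _) = x

ω₂ : List ℕ → ℚ
ω₂ []      = 1ℚ
ω₂ (a ∷ π) = ((+ a ℤ.- + b ℤ.- δₑ a ℤ.- δₑ b) ℚ./ 2) ℚ.* ω₂ π
  where b = headOr0 π

-- compositions⁺ n lists the compositions of n + 1, with (x , xs) standing for
-- the composition (x + 1) ∷ xs.
compositions⁺ : ℕ → List (ℕ × List ℕ)
compositions⁺ zero    = (0 , []) ∷ []
compositions⁺ (suc n) =
     map (λ (x , xs) → 0 , suc x ∷ xs) (compositions⁺ n)
  ++ map (λ (x , xs) → suc x , xs)     (compositions⁺ n)

compositions : ℕ → List (List ℕ)
compositions zero    = [] ∷ []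
compositions (suc n) = map (λ (x , xs) → suc x ∷ xs) (compositions⁺ n)

isPartition? : Decidable IsPartition
isPartition? π = map′ (λ (p , l) → mkIsPartition p l)
                      (λ p → IsPartition.positive p , IsPartition.nonIncreasing p)
                      (All.all? (0 <?_) π ×-dec linked? _≥?_ π)

-- All partitions of n, each listed exactly once; see ∈-partitions and
-- partitions-unique.
partitions : ℕ → List (List ℕ)
partitions n = filter isPartition? (compositions n)

-- A formal power series in q is identified with its sequence of coefficients;
-- the coefficient of qⁿ in ∑_{π ∈ P} w(π) q^|π| is the sum of w over the
-- partitions of n that lie in P.
PowerSeries : Set
PowerSeries = ℕ → ℚ

generatingFunction : {P : List ℕ → Set} → Decidable P → (List ℕ → ℚ) → PowerSeries
generatingFunction P? w n = foldr ℚ._+_ 0ℚ (map w (filter P? (partitions n)))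

compositions⁺-sum : ∀ n {x xs} → (x , xs) ∈ compositions⁺ n → x + sum xs ≡ n
compositions⁺-sum zero    (here refl) = refl
compositions⁺-sum (suc n) p with ∈-++⁻ (map _ (compositions⁺ n)) p
... | inj₁ q with ((y , ys) , r , refl) ← ∈-map⁻ _ q = cong suc (compositions⁺-sum n r)
... | inj₂ q with ((y , ys) , r , refl) ← ∈-map⁻ _ q = cong suc (compositions⁺-sum n r)

compositions⁺-complete : ∀ n {x xs} → All (0 <_) xs → x + sum xs ≡ n →
                         (x , xs) ∈ compositions⁺ n
compositions⁺-complete zero    {zero}  []              e = here refl
compositions⁺-complete zero    {zero}  (s≤s _ ∷ _)     ()
compositions⁺-complete (suc n) {zero}  []              ()
compositions⁺-complete (suc n) {zero}  (s≤s z≤n ∷ pxs) e =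
  ∈-++⁺ˡ (∈-map⁺ _ (compositions⁺-complete n pxs (suc-injective e)))
compositions⁺-complete (suc n) {suc x} pxs             e =
  ∈-++⁺ʳ (map _ (compositions⁺ n)) (∈-map⁺ _ (compositions⁺-complete n pxs (suc-injective e)))

compositions⁺-unique : ∀ n → Unique (compositions⁺ n)
compositions⁺-unique zero    = [] ∷ []
compositions⁺-unique (suc n) =
  Unique.++⁺ (Unique.map⁺ (λ { refl → refl }) (compositions⁺-unique n))
             (Unique.map⁺ (λ { refl → refl }) (compositions⁺-unique n))
             disjoint
  where
  disjoint : ∀ {v} → ¬ (v ∈ map (λ (x , xs) → 0 , suc x ∷ xs) (compositions⁺ n)
                      × v ∈ map (λ (x , xs) → suc x , xs) (compositions⁺ n))
  disjoint (p , q) with (_ , _ , refl) ← ∈-map⁻ _ p with (_ , _ , ()) ← ∈-map⁻ _ q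

∈-partitions : ∀ {π n} → π ∈ partitions n ⇔ (IsPartition π × sum π ≡ n)
∈-partitions {π} {n} = mk⇔ (to n) (λ (p , e) → from π n p e)
  where
  to : ∀ n → π ∈ partitions n → IsPartition π × sum π ≡ n
  to n p with (q , isP) ← ∈-filter⁻ isPartition? {xs = compositions n} p = isP , total n q
    where
    total : ∀ n → π ∈ compositions n → sum π ≡ n
    total zero    (here refl) = refl
    total (suc n) q with (_ , r , refl) ← ∈-map⁻ _ q = cong suc (compositions⁺-sum n r)

  from : ∀ π n → IsPartition π → sum π ≡ n → π ∈ partitions n
  from π n isP e = ∈-filter⁺ isPartition? (member π n (IsPartition.positive isP) e) isP
    where
    member : ∀ π n → All (0 <_) π → sum π ≡ n → π ∈ compositions n
    member []       zero    _                e = here refl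
    member (_ ∷ _)  zero    (s≤s _ ∷ _)      ()
    member (_ ∷ _)  (suc n) (s≤s z≤n ∷ pxs)  e =
      ∈-map⁺ _ (compositions⁺-complete n pxs (suc-injective e))

partitions-unique : ∀ n → Unique (partitions n)
partitions-unique n = Unique.filter⁺ isPartition? (compositions-unique n)
  where
  compositions-unique : ∀ n → Unique (compositions n)
  compositions-unique zero    = [] ∷ []
  compositions-unique (suc n) = Unique.map⁺ (λ { refl → refl }) (compositions⁺-unique n)

∈⇒≤sum : ∀ {x π} → x ∈ π → x ≤ sum π
∈⇒≤sum {π = y ∷ π} (here refl) = m≤m+n y (sum π)
∈⇒≤sum {π = y ∷ π} (there p)   = ≤-trans (∈⇒≤sum p) (m≤n+m (sum π) y)

freq>0⇒∈ : ∀ i π → 1 ≤ freq i π → i ∈ π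
freq>0⇒∈ i π p with filter (i ≟_) π in eq
... | y ∷ _ with (y∈π , refl) ← ∈-filter⁻ (i ≟_) {xs = π} (subst (y ∈_) (sym eq) (here refl)) = y∈π

private
  n≤2*n : ∀ n → n ≤ 2 * n
  n≤2*n n = m≤m+n n (n + 0)

  all? : ∀ {P : ℕ → Set} → Decidable P → ∀ b → (∀ n → ¬ P n → n < b) → Dec (∀ n → P n)
  all? {P} P? b bound = map′ decide (λ h {n} _ → h n) (allUpTo? P? b)
    where
    decide : (∀ {n} → n < b → P n) → ∀ n → P n
    decide h n with P? n
    ... | yes p  = p
    ... | no  ¬p = h (bound n ¬p)

  any? : ∀ {P : ℕ → Set} → Decidable P → ∀ b → (∀ n → P n → n < b) → Dec (∃ P)
  any? P? b bound = map′ (λ (n , _ , p) → n , p) (λ (n , p) → n , bound n p , p) (anyUpTo? P? b)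

  odd? : Decidable Odd
  odd? n = ¬? (2 ∣? n)

  noConsecutiveEvens? : ∀ π → Dec (∀ k → ¬ (2 * k ∈ π × 2 * k + 2 ∈ π))
  noConsecutiveEvens? π =
    all? (λ k → ¬? (2 * k ∈? π ×-dec 2 * k + 2 ∈? π)) (suc (sum π)) bound
    where
    bound : ∀ k → ¬ ¬ (2 * k ∈ π × 2 * k + 2 ∈ π) → k < suc (sum π)
    bound k h with k <? suc (sum π)
    ... | yes k< = k<
    ... | no  k≮ = ⊥-elim (h λ (p , _) → k≮ (s≤s (≤-trans (n≤2*n k) (∈⇒≤sum p))))

  oddPartsDistinct? : ∀ π → Dec (∀ i → Odd i → freq i π ≤ 1)
  oddPartsDistinct? π = all? (λ i → odd? i →-dec freq i π ≤? 1) (suc (sum π)) bound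
    where
    bound : ∀ i → ¬ (Odd i → freq i π ≤ 1) → i < suc (sum π)
    bound i h = s≤s (∈⇒≤sum (freq>0⇒∈ i π (<⇒≤ (≰⇒> (λ le → h λ _ → le)))))

  evensPresent? : ∀ π b → Dec (∀ i → 1 ≤ i → i ≤ b → 1 ≤ freq (2 * i) π)
  evensPresent? π b =
    all? (λ i → 1 ≤? i →-dec i ≤? b →-dec 1 ≤? freq (2 * i) π) (suc b) bound
    where
    bound : ∀ i → ¬ (1 ≤ i → i ≤ b → 1 ≤ freq (2 * i) π) → i < suc b
    bound i h with i ≤? b
    ... | yes i≤b = s≤s i≤b
    ... | no  i≰b = ⊥-elim (h λ _ i≤b → ⊥-elim (i≰b i≤b))

  oddsAbsent? : ∀ π b → Dec (∀ i → Odd i → i < b → freq i π ≡ 0)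
  oddsAbsent? π b = all? (λ i → odd? i →-dec i <? b →-dec freq i π ≟ 0) b bound
    where
    bound : ∀ i → ¬ (Odd i → i < b → freq i π ≡ 0) → i < b
    bound i h with i <? b
    ... | yes i<b = i<b
    ... | no  i≮b = ⊥-elim (h λ _ i<b → ⊥-elim (i≮b i<b))

  start₁? : ∀ π → Decidable (Start₁ π)
  start₁? π j = map′ (λ (e , o , s) → mkStart₁ e o s)
                     (λ (mkStart₁ e o s) → e , o , s)
                     (evensPresent? π (2 * j ∸ 1) ×-dec freq (4 * j ∸ 1) π ≟ 1
                      ×-dec oddsAbsent? π (4 * j ∸ 1))

  start₂? : ∀ π → Decidable (Start₂ π)
  start₂? π j = map′ (λ (e , g , s) → mkStart₂ e g λ i o i≤ → s i o (s≤s i≤))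
                     (λ (mkStart₂ e g s) → e , g , λ i o i< → s i o (s≤s⁻¹ i<))
                     (evensPresent? π (2 * j) ×-dec freq (4 * j + 2) π ≟ 0
                      ×-dec oddsAbsent? π (suc (4 * j + 1)))

  starts? : ∀ π → Dec (∃ λ j → 1 ≤ j × (Start₁ π j ⊎ Start₂ π j))
  starts? π = any? (λ j → 1 ≤? j ×-dec (start₁? π j ⊎-dec start₂? π j)) (suc (sum π)) bound
    where
    present : ∀ j → 1 ≤ j → Start₁ π j ⊎ Start₂ π j → 1 ≤ freq (2 * j) π
    present (suc j) 1≤j (inj₁ s) =
      Start₁.evensPresent s (suc j) 1≤j (≤-trans (m≤n+m (suc j) j)
        (≤-reflexive (cong (λ k → j + suc k) (sym (+-identityʳ j)))))
    present j 1≤j (inj₂ s) = Start₂.evensPresent s j 1≤j (n≤2*n j)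

    bound : ∀ j → 1 ≤ j × (Start₁ π j ⊎ Start₂ π j) → j < suc (sum π)
    bound j (1≤j , s) = s≤s (≤-trans (n≤2*n j) (∈⇒≤sum (freq>0⇒∈ (2 * j) π (present j 1≤j s))))

GG₂? : Decidable GG₂
GG₂? π = map′ (λ (p , t , d , c) → mkGG₂ p t d c)
              (λ (mkGG₂ p t d c) → p , t , d , c)
              (isPartition? π ×-dec All.all? (3 ≤?_) π
               ×-dec linked? (λ a b → b + 2 ≤? a) π ×-dec noConsecutiveEvens? π)

Prdo? : Decidable Prdo
Prdo? π = map′ (λ (p , o , s , t) → mkPrdo p o s t)
               (λ (mkPrdo p o s t) → p , o , s , t)
               (isPartition? π ×-dec oddPartsDistinct? π ×-dec All.all? (1 <?_) π
                ×-dec (Maybe.≡-dec _≟_ (last π) (just 2) →-dec starts? π))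

{-# OPTIONS --safe #-}
module Submission where

-- For a > b the factor of ω₂ attached to consecutive parts a, b is the number of even
-- integers strictly between them, and the product of these numbers vanishes outside GG₂.
-- Let A k be the generating function of the weights in which the final 0 is replaced by
-- 2k, and C k that of the weights without the last factor, the last part exceeding 2k. Then
--   A k = A (k+1) + C (k+1),   C k = C (k+1) + q^(2k+1) A k + q^(2k+2) A (k+1),
-- and with the limits A k → 1, C k → 0 these recurrences determine A. Heine's
-- transformation suggests the solution
--   A k = (q²;q²)∞⁻¹ ∑ⱼ (-1)ʲ q^(j²+j) [k+j choose j] (-q^(2k+2j+3);q²)∞
-- (with q²-binomial coefficients), which follows from both Pascal rules. On the other side,
-- the alternating sum at k = 0 counts Prdo: with ω l counting the partitions whose odd
-- parts are distinct and ≥ 2l+3, the partitions failing the condition of Prdo at level l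
-- are obtained by adding a part 2l+2 to those satisfying it at level l+1.

open import Defs
open import Data.Empty using (⊥-elim)
open import Data.Integer.Base as ℤ using (ℤ; 0ℤ)
import Data.Integer.Properties as ℤ
import Data.Integer.Tactic.RingSolver as ℤSolver
open import Data.List.Base using (List; []; _∷_; map; filter; foldr; length; last)
open import Data.List.Membership.Propositional using (_∈_; _∉_)
open import Data.List.Membership.Propositional.Properties
  using (∈-map⁺; ∈-map⁻; ∈-filter⁺; ∈-filter⁻)
open import Data.List.Membership.Propositional.Properties.WithK using (unique∧set⇒bag)
open import Data.List.Properties using (filter-accept; filter-reject; map-∘)
open import Data.List.Relation.Binary.BagAndSetEquality using (∼bag⇒↭)
open import Data.List.Relation.Binary.Permutation.Propositional
  using (_↭_; ↭-refl; ↭-sym; ↭-trans; prep; swap)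
open import Data.List.Relation.Binary.Permutation.Propositional.Properties
  using (∈-resp-↭; All-resp-↭; ↭-length; filter-↭; map⁺)
open import Data.List.Relation.Unary.All as All using (All; []; _∷_)
open import Data.List.Relation.Unary.AllPairs using (AllPairs; []; _∷_)
open import Data.List.Relation.Unary.Any using (here; there)
open import Data.List.Relation.Unary.Linked using (Linked; []; [-]; _∷_)
open import Data.List.Relation.Unary.Linked.Properties using (AllPairs⇒Linked; Linked⇒AllPairs)
import Data.List.Relation.Unary.Unique.Propositional.Properties as Unique
open import Data.Maybe.Base using (just)
open import Data.Nat.Base
open import Data.Nat.Divisibility using (_∣?_; m∣m*n; ∣m+n∣m⇒∣n; ∣m∣n⇒∣m+n)
open import Data.Nat.ListAction using (sum)
open import Data.Nat.ListAction.Properties using (sum-↭)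
open import Data.Nat.Properties
open import Algebra.Properties.CommutativeSemigroup +-commutativeSemigroup using (interchange)
open import Data.List.Membership.DecPropositional _≟_ using (_∈?_)
import Data.Nat.Tactic.RingSolver as ℕSolver
open import Data.Product.Base using (_×_; _,_; proj₁; proj₂; ∃)
open import Data.Rational.Base as ℚ using (ℚ; 0ℚ; 1ℚ)
open import Data.Rational.Literals using (fromℤ)
import Data.Rational.Properties as ℚ
open import Data.Rational.Unnormalised.Base using (mkℚᵘ; *≡*)
import Data.Rational.Unnormalised.Properties as ℚᵘ
open import Data.Sum.Base using (_⊎_; inj₁; inj₂; [_,_]′)
open import Data.Unit.Base using (⊤; tt)
open import Function.Base using (_∘_)
open import Function.Bundles using (_⇔_; mk⇔; Equivalence)
open import Relation.Binary.PropositionalEquality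
open import Relation.Nullary using (¬_; Dec; yes; no; contradiction)
open import Relation.Nullary.Decidable
  using (map′; _×-dec_; _→-dec_; ¬?; from-no; decidable-stable)

-- Power series

Series : Set
Series = ℕ → ℤ

-- shift c f is qᶜ f.
shift : ℕ → Series → Series
shift zero    f n       = f n
shift (suc c) f zero    = 0ℤ
shift (suc c) f (suc n) = shift c f n

-- The hypothesis only concerns the coefficient at `i` with `i + c ≡ n`. For `c > 0` it lies in
-- lower degree, which lets inductions on the degree pass through a shift.
shift-cong : ∀ {f g} c n → (∀ i → i + c ≡ n → f i ≡ g i) → shift c f n ≡ shift c g n
shift-cong zero    n       h = h n (+-identityʳ n)
shift-cong (suc c) zero    h = refl
shift-cong (suc c) (suc n) h =
  shift-cong c n λ i e → h i (trans (+-suc i c) (cong suc e))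

shift-+ : ∀ f g c n → shift c (λ i → f i ℤ.+ g i) n ≡ shift c f n ℤ.+ shift c g n
shift-+ f g zero    n       = refl
shift-+ f g (suc c) zero    = refl
shift-+ f g (suc c) (suc n) = shift-+ f g c n

shift-- : ∀ f g c n → shift c (λ i → f i ℤ.- g i) n ≡ shift c f n ℤ.- shift c g n
shift-- f g zero    n       = refl
shift-- f g (suc c) zero    = refl
shift-- f g (suc c) (suc n) = shift-- f g c n

shift-shift : ∀ f c d n → shift c (shift d f) n ≡ shift (c + d) f n
shift-shift f zero    d n       = refl
shift-shift f (suc c) d zero    = refl
shift-shift f (suc c) d (suc n) = shift-shift f c d n

shift-exponent : ∀ {f c d} n → c ≡ d → shift c f n ≡ shift d f n
shift-exponent n refl = refl

shift-≡0 : ∀ f {c n} → n < c → shift c f n ≡ 0ℤ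
shift-≡0 f {suc c} {zero}  _       = refl
shift-≡0 f {suc c} {suc n} (s≤s p) = shift-≡0 f p

i+c≡n⇒i<n : ∀ {i c n} → i + suc c ≡ n → i < n
i+c≡n⇒i<n {i} {c} refl = m<m+n i (s≤s z≤n)

-- Alternating q-binomial sums and the solution of the recurrences

-- β k l m is (q²;q²)∞⁻¹ ∑ⱼ (-1)ʲ q^(j²+j+2mj) [k+j-1 choose j] (-q^(2l+2j+3);q²)∞
-- (q²-binomial coefficients) when ω l is (-q^(2l+3);q²)∞ / (q²;q²)∞; the
-- defining recurrence is a Pascal rule.
module Heine (ω : ℕ → Series) where

  mutual
    β : ℕ → ℕ → ℕ → Series
    β zero    l m n = ω l n
    β (suc k) l m n = β k l m n ℤ.- βNext (suc (2 * k + 2 * m)) k l m n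

    -- βNext c k l m is q^(c+1) β (k+1) (l+1) (m+1), inlined for the termination checker.
    βNext : ℕ → ℕ → ℕ → ℕ → Series
    βNext c       k l m zero    = 0ℤ
    βNext zero    k l m (suc n) = β (suc k) (suc l) (suc m) n
    βNext (suc c) k l m (suc n) = βNext c k l m n

  exponent : ℕ → ℕ → ℕ
  exponent k m = suc (suc (2 * k + 2 * m))

  βNext≡shift : ∀ c k l m n → βNext c k l m n ≡ shift (suc c) (β (suc k) (suc l) (suc m)) n
  βNext≡shift c       k l m zero    = refl
  βNext≡shift zero    k l m (suc n) = refl
  βNext≡shift (suc c) k l m (suc n) = βNext≡shift c k l m n

  β-pascal : ∀ k l m n →
    β (suc k) l m n ≡ β k l m n ℤ.- shift (exponent k m) (β (suc k) (suc l) (suc m)) n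
  β-pascal k l m n = cong (λ x → β k l m n ℤ.- x) (βNext≡shift _ k l m n)

  module _ (ω-step : ∀ l n → ω l n ≡ ω (suc l) n ℤ.+ shift (2 * l + 3) (ω (suc l)) n) where

    -- The recurrence of `ω` in `l` is carried through the Pascal rule by induction on `k`. The
    -- subtracted term keeps the index `suc k` but is shifted, so there the degree drops; hence the
    -- outer induction on a strict bound `N` of the degree.
    β-raiseˡ : ∀ k l m n →
      β k l m n ≡ β k (suc l) m n ℤ.+ shift (2 * l + 3) (β k (suc l) (suc m)) n
    β-raiseˡ k l m n = bounded (suc n) k l m n ≤-refl
      where
      bounded : ∀ N k l m n → n < N →
        β k l m n ≡ β k (suc l) m n ℤ.+ shift (2 * l + 3) (β k (suc l) (suc m)) n
      bounded (suc N) zero    l m n n<N = ω-step l n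
      bounded (suc N) (suc k) l m n n<N = begin
        β (suc k) l m n
          ≡⟨ β-pascal k l m n ⟩
        β k l m n ℤ.- shift e (β (suc k) (suc l) (suc m)) n
          ≡⟨ cong₂ ℤ._-_ (bounded (suc N) k l m n n<N) expandNext ⟩
        (a ℤ.+ b) ℤ.- (c ℤ.+ d)
          ≡⟨ regroup a b c d ⟩
        (a ℤ.- c) ℤ.+ (b ℤ.- d)
          ≡⟨ cong₂ ℤ._+_ (β-pascal k (suc l) m n) expandShift ⟨
        β (suc k) (suc l) m n ℤ.+ shift o (β (suc k) (suc l) (suc m)) n ∎
        where
        open ≡-Reasoning
        e = exponent k m
        o = 2 * l + 3
        a = β k (suc l) m n
        b = shift o (β k (suc l) (suc m)) n
        c = shift e (β (suc k) (suc (suc l)) (suc m)) n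
        -- This term arises on both sides, by raising `l` inside the Pascal term and by applying the
        -- Pascal rule inside the shifted term; `exponents` equates the two total shifts.
        d = shift (o + exponent k (suc m)) (β (suc k) (suc (suc l)) (suc (suc m))) n
        regroup : ∀ a b c d → (a ℤ.+ b) ℤ.- (c ℤ.+ d) ≡ (a ℤ.- c) ℤ.+ (b ℤ.- d)
        regroup = ℤSolver.solve-∀
        exponents : ∀ k l m → suc (suc (2 * k + 2 * m)) + (2 * suc l + 3) ≡
                    (2 * l + 3) + suc (suc (2 * k + 2 * suc m))
        exponents = ℕSolver.solve-∀
        expandNext : shift e (β (suc k) (suc l) (suc m)) n ≡ c ℤ.+ d
        expandNext = begin
          shift e (β (suc k) (suc l) (suc m)) n
            ≡⟨ shift-cong e n (λ i p → bounded N (suc k) (suc l) (suc m) i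
                 (<-≤-trans (i+c≡n⇒i<n p) (s≤s⁻¹ n<N))) ⟩
          shift e (λ i → β (suc k) (suc (suc l)) (suc m) i
                       ℤ.+ shift (2 * suc l + 3) (β (suc k) (suc (suc l)) (suc (suc m))) i) n
            ≡⟨ shift-+ (β (suc k) (suc (suc l)) (suc m)) _ e n ⟩
          c ℤ.+ shift e (shift (2 * suc l + 3) (β (suc k) (suc (suc l)) (suc (suc m)))) n
            ≡⟨ cong (ℤ._+_ c) (trans (shift-shift _ e _ n) (shift-exponent n (exponents k l m))) ⟩
          c ℤ.+ d ∎
        expandShift : shift o (β (suc k) (suc l) (suc m)) n ≡ b ℤ.- d
        expandShift = begin
          shift o (β (suc k) (suc l) (suc m)) n
            ≡⟨ shift-cong o n (λ i _ → β-pascal k (suc l) (suc m) i) ⟩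
          shift o (λ i → β k (suc l) (suc m) i
                       ℤ.- shift (exponent k (suc m)) (β (suc k) (suc (suc l)) (suc (suc m))) i) n
            ≡⟨ shift-- (β k (suc l) (suc m)) _ o n ⟩
          b ℤ.- shift o (shift (exponent k (suc m)) (β (suc k) (suc (suc l)) (suc (suc m)))) n
            ≡⟨ cong (λ x → b ℤ.- x) (shift-shift _ o _ n) ⟩
          b ℤ.- d ∎

  -- The other Pascal rule.
  β-raiseᵐ : ∀ k l m n →
    β (suc k) l m n ≡ β k l (suc m) n ℤ.- shift (2 * m + 2) (β (suc k) (suc l) (suc m)) n
  β-raiseᵐ k l m n = bounded (suc n) k l m n ≤-refl
    where
    base : ∀ m → suc (suc (2 * m)) ≡ 2 * m + 2
    base = ℕSolver.solve-∀
    bounded : ∀ N k l m n → n < N →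
      β (suc k) l m n ≡ β k l (suc m) n ℤ.- shift (2 * m + 2) (β (suc k) (suc l) (suc m)) n
    -- For `k = 0` the two Pascal rules coincide, as `β 0 l m` is `ω l` for every `m`.
    bounded (suc N) zero    l m n n<N = trans (β-pascal 0 l m n)
      (cong (λ x → ω l n ℤ.- x) (shift-exponent n (base m)))
    bounded (suc N) (suc k) l m n n<N = begin
      β (suc (suc k)) l m n
        ≡⟨ β-pascal (suc k) l m n ⟩
      β (suc k) l m n ℤ.- shift e (β (suc (suc k)) (suc l) (suc m)) n
        ≡⟨ cong₂ ℤ._-_ (bounded (suc N) k l m n n<N) expandNext ⟩
      (a ℤ.- b) ℤ.- (c ℤ.- d)
        ≡⟨ regroup a b c d ⟩
      (a ℤ.- c) ℤ.- (b ℤ.- d)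
        ≡⟨ cong₂ ℤ._-_ pascalNext expandShift ⟨
      β (suc k) l (suc m) n ℤ.- shift o (β (suc (suc k)) (suc l) (suc m)) n ∎
      where
      open ≡-Reasoning
      e = exponent (suc k) m
      o = 2 * m + 2
      a = β k l (suc m) n
      b = shift o (β (suc k) (suc l) (suc m)) n
      c = shift e (β (suc k) (suc l) (suc (suc m))) n
      d = shift (o + exponent (suc k) (suc m)) (β (suc (suc k)) (suc (suc l)) (suc (suc m))) n
      regroup : ∀ a b c d → (a ℤ.- b) ℤ.- (c ℤ.- d) ≡ (a ℤ.- c) ℤ.- (b ℤ.- d)
      regroup = ℤSolver.solve-∀
      exponents₁ : ∀ k m → suc (suc (2 * suc k + 2 * m)) + (2 * suc m + 2) ≡
                   (2 * m + 2) + suc (suc (2 * suc k + 2 * suc m))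
      exponents₁ = ℕSolver.solve-∀
      exponents₂ : ∀ k m → suc (suc (2 * k + 2 * suc m)) ≡ suc (suc (2 * suc k + 2 * m))
      exponents₂ = ℕSolver.solve-∀
      pascalNext : β (suc k) l (suc m) n ≡ a ℤ.- c
      pascalNext = trans (β-pascal k l (suc m) n)
        (cong (λ x → a ℤ.- x) (shift-exponent n (exponents₂ k m)))
      expandNext : shift e (β (suc (suc k)) (suc l) (suc m)) n ≡ c ℤ.- d
      expandNext = begin
        shift e (β (suc (suc k)) (suc l) (suc m)) n
          ≡⟨ shift-cong e n (λ i p → bounded N (suc k) (suc l) (suc m) i
               (<-≤-trans (i+c≡n⇒i<n p) (s≤s⁻¹ n<N))) ⟩
        shift e (λ i → β (suc k) (suc l) (suc (suc m)) i
                     ℤ.- shift (2 * suc m + 2) (β (suc (suc k)) (suc (suc l)) (suc (suc m))) i) n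
          ≡⟨ shift-- (β (suc k) (suc l) (suc (suc m))) _ e n ⟩
        c ℤ.- shift e (shift (2 * suc m + 2) (β (suc (suc k)) (suc (suc l)) (suc (suc m)))) n
          ≡⟨ cong (λ x → c ℤ.- x) (trans (shift-shift _ e _ n) (shift-exponent n (exponents₁ k m))) ⟩
        c ℤ.- d ∎
      expandShift : shift o (β (suc (suc k)) (suc l) (suc m)) n ≡ b ℤ.- d
      expandShift = begin
        shift o (β (suc (suc k)) (suc l) (suc m)) n
          ≡⟨ shift-cong o n (λ i _ → β-pascal (suc k) (suc l) (suc m) i) ⟩
        shift o (λ i → β (suc k) (suc l) (suc m) i
                     ℤ.- shift (exponent (suc k) (suc m)) (β (suc (suc k)) (suc (suc l)) (suc (suc m))) i) n
          ≡⟨ shift-- (β (suc k) (suc l) (suc m)) _ o n ⟩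
        b ℤ.- shift o (shift (exponent (suc k) (suc m)) (β (suc (suc k)) (suc (suc l)) (suc (suc m)))) n
          ≡⟨ cong (λ x → b ℤ.- x) (shift-shift _ o _ n) ⟩
        b ℤ.- d ∎

  -- Here `c m` stands for 1/(q²;q²)ₘ: `c-step` divides by 1 - q^(2m+2), and `ω-c` says that `ω l`
  -- and `c m` agree in low degrees, both tending to (q²;q²)∞⁻¹.
  module _
    (ω-step : ∀ l n → ω l n ≡ ω (suc l) n ℤ.+ shift (2 * l + 3) (ω (suc l)) n)
    (c      : ℕ → Series)
    (c-step : ∀ m n → c (suc m) n ≡ c m n ℤ.+ shift (2 * m + 2) (c (suc m)) n)
    (ω-c    : ∀ l m n → n ≤ l → n ≤ m → ω l n ≡ c m n)
    where

    -- Every subtracted term begins at q^(2k+2m+2) or later, beyond degree `m`.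
    β≡ω : ∀ k l m n → n ≤ m → β k l m n ≡ ω l n
    β≡ω zero    l m n n≤m = refl
    β≡ω (suc k) l m n n≤m = begin
      β (suc k) l m n
        ≡⟨ β-pascal k l m n ⟩
      β k l m n ℤ.- shift (exponent k m) (β (suc k) (suc l) (suc m)) n
        ≡⟨ cong₂ ℤ._-_ (β≡ω k l m n n≤m) (shift-≡0 (β (suc k) (suc l) (suc m)) n<e) ⟩
      ω l n ℤ.- 0ℤ
        ≡⟨ ℤ.+-identityʳ _ ⟩
      ω l n ∎
      where
      open ≡-Reasoning
      n<e : n < exponent k m
      n<e = s≤s (m≤n⇒m≤1+n (≤-trans n≤m
              (≤-trans (m≤m+n m (m + 0)) (m≤n+m (2 * m) (2 * k)))))

    -- For large `k` and `l` this is Euler's identity for (q^(2m+2);q²)∞. The second Pascal rule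
    -- raises `m` at most `d` times, until `n ≤ m` and `β≡ω` applies; `c-step` undoes each raise.
    -- Each use on the main term costs one unit of `k`, hence `d ≤ k`.
    β-limit : ∀ d k l m n → n ≤ l → n ≤ m + d → d ≤ k → β k l m n ≡ c m n
    β-limit zero    k       l m n n≤l n≤m _ =
      trans (β≡ω k l m n n≤m′) (ω-c l m n n≤l n≤m′)
      where n≤m′ = subst (n ≤_) (+-identityʳ m) n≤m
    β-limit (suc d) (suc k) l m n n≤l n≤m (s≤s d≤k) = begin
      β (suc k) l m n
        ≡⟨ β-raiseᵐ k l m n ⟩
      β k l (suc m) n ℤ.- shift o (β (suc k) (suc l) (suc m)) n
        ≡⟨ cong₂ ℤ._-_ (β-limit d k l (suc m) n n≤l n≤m′ d≤k)
             (shift-cong o n λ i e → let i≤n = m+n≤o⇒m≤o i (≤-reflexive e) in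
               β-limit d (suc k) (suc l) (suc m) i
                 (m≤n⇒m≤1+n (≤-trans i≤n n≤l)) (≤-trans i≤n n≤m′) (m≤n⇒m≤1+n d≤k)) ⟩
      c (suc m) n ℤ.- shift o (c (suc m)) n
        ≡⟨ cong (ℤ._- shift o (c (suc m)) n) (c-step m n) ⟩
      (c m n ℤ.+ shift o (c (suc m)) n) ℤ.- shift o (c (suc m)) n
        ≡⟨ cancel _ _ ⟩
      c m n ∎
      where
      open ≡-Reasoning
      o = 2 * m + 2
      n≤m′ = subst (n ≤_) (+-suc m d) n≤m
      cancel : ∀ x y → (x ℤ.+ y) ℤ.- y ≡ x
      cancel = ℤSolver.solve-∀

    -- This is the recurrence `A-step` for the proposed solution. Both diagonal series are compared
    -- with `β (suc k) (suc k) 0`, one by raising `l` and the other by the first Pascal rule.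
    β-diagonal-step : ∀ k n →
      β (suc k) k 0 n ≡ β (suc (suc k)) (suc k) 0 n
                      ℤ.+ (shift (2 * k + 3) (β (suc k) (suc k) 1) n
                       ℤ.+ shift (2 * k + 4) (β (suc (suc k)) (suc (suc k)) 1) n)
    β-diagonal-step k n = begin
      β (suc k) k 0 n
        ≡⟨ β-raiseˡ ω-step (suc k) k 0 n ⟩
      b ℤ.+ x
        ≡⟨ regroup b x y ⟩
      (b ℤ.- y) ℤ.+ (x ℤ.+ y)
        ≡⟨ cong (ℤ._+ (x ℤ.+ y)) (trans (β-pascal (suc k) (suc k) 0 n)
             (cong (λ t → b ℤ.- t) (shift-exponent n (exponents k)))) ⟨
      β (suc (suc k)) (suc k) 0 n ℤ.+ (x ℤ.+ y) ∎
      where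
      open ≡-Reasoning
      b = β (suc k) (suc k) 0 n
      x = shift (2 * k + 3) (β (suc k) (suc k) 1) n
      y = shift (2 * k + 4) (β (suc (suc k)) (suc (suc k)) 1) n
      regroup : ∀ b x y → b ℤ.+ x ≡ (b ℤ.- y) ℤ.+ (x ℤ.+ y)
      regroup = ℤSolver.solve-∀
      exponents : ∀ k → suc (suc (2 * suc k + 2 * 0)) ≡ 2 * k + 4
      exponents = ℕSolver.solve-∀

    -- The second Pascal rule writes a shifted diagonal series as a difference of the terms that
    -- make up `D`, so that `D-step` telescopes.
    shift-β-diagonal : ∀ e k n →
      shift e (β (suc (suc k)) (suc k) 0) n
        ≡ shift e (β (suc k) (suc k) 1) n ℤ.- shift (e + 2) (β (suc (suc k)) (suc (suc k)) 1) n
    shift-β-diagonal e k n = begin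
      shift e (β (suc (suc k)) (suc k) 0) n
        ≡⟨ shift-cong e n (λ i _ → β-raiseᵐ (suc k) (suc k) 0 i) ⟩
      shift e (λ i → β (suc k) (suc k) 1 i ℤ.- shift 2 (β (suc (suc k)) (suc (suc k)) 1) i) n
        ≡⟨ shift-- (β (suc k) (suc k) 1) _ e n ⟩
      shift e (β (suc k) (suc k) 1) n ℤ.- shift e (shift 2 (β (suc (suc k)) (suc (suc k)) 1)) n
        ≡⟨ cong (λ t → shift e (β (suc k) (suc k) 1) n ℤ.- t) (shift-shift _ e 2 n) ⟩
      shift e (β (suc k) (suc k) 1) n ℤ.- shift (e + 2) (β (suc (suc k)) (suc (suc k)) 1) n ∎
      where open ≡-Reasoning

    module _
      (A C     : ℕ → Series)
      (A-step  : ∀ k n → A k n ≡ A (suc k) n ℤ.+ C (suc k) n)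
      (C-step  : ∀ k n → C k n ≡ C (suc k) n ℤ.+ (shift (2 * k + 1) (A k) n
                                              ℤ.+ shift (2 * k + 2) (A (suc k)) n))
      (A-limit : ∀ k n → n ≤ k → A k n ≡ c 0 n)
      (C-limit : ∀ k n → n ≤ k → C k n ≡ 0ℤ)
      where

      A≡β : ∀ k n → A k n ≡ β (suc k) k 0 n
      A≡β k n = proj₁ (descend n k n ≤-refl (m≤m+n n k))
        where
        -- The value that `β-diagonal-step` forces on `C (suc k)` if `A` is the diagonal series.
        D : ℕ → Series
        D k n = shift (2 * k + 3) (β (suc k) (suc k) 1) n
              ℤ.+ shift (2 * k + 4) (β (suc (suc k)) (suc (suc k)) 1) n

        D-step : ∀ k n → D k n ≡ D (suc k) n
          ℤ.+ (shift (2 * suc k + 1) (β (suc (suc k)) (suc k) 0) n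
           ℤ.+ shift (2 * suc k + 2) (β (suc (suc (suc k))) (suc (suc k)) 0) n)
        D-step k n = begin
          x ℤ.+ y
            ≡⟨ regroup x y z t ⟩
          (z ℤ.+ t) ℤ.+ ((x ℤ.- z) ℤ.+ (y ℤ.- t))
            ≡⟨ cong (ℤ._+_ (z ℤ.+ t)) (cong₂ ℤ._+_
                 (trans (shift-β-diagonal (2 * suc k + 1) k n)
                   (cong₂ ℤ._-_ (shift-exponent n (e₁ k)) (shift-exponent n (e₂ k))))
                 (trans (shift-β-diagonal (2 * suc k + 2) (suc k) n)
                   (cong₂ ℤ._-_ (shift-exponent n (e₃ k)) (shift-exponent n (e₄ k))))) ⟨
          D (suc k) n ℤ.+ _ ∎
          where
          open ≡-Reasoning
          x = shift (2 * k + 3) (β (suc k) (suc k) 1) n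
          y = shift (2 * k + 4) (β (suc (suc k)) (suc (suc k)) 1) n
          z = shift (2 * suc k + 3) (β (suc (suc k)) (suc (suc k)) 1) n
          t = shift (2 * suc k + 4) (β (suc (suc (suc k))) (suc (suc (suc k))) 1) n
          regroup : ∀ x y z t → x ℤ.+ y ≡ (z ℤ.+ t) ℤ.+ ((x ℤ.- z) ℤ.+ (y ℤ.- t))
          regroup = ℤSolver.solve-∀
          e₁ : ∀ k → 2 * suc k + 1 ≡ 2 * k + 3
          e₁ = ℕSolver.solve-∀
          e₂ : ∀ k → 2 * suc k + 1 + 2 ≡ 2 * suc k + 3
          e₂ = ℕSolver.solve-∀
          e₃ : ∀ k → 2 * suc k + 2 ≡ 2 * k + 4
          e₃ = ℕSolver.solve-∀
          e₄ : ∀ k → 2 * suc k + 2 + 2 ≡ 2 * suc k + 4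
          e₄ = ℕSolver.solve-∀

        D-limit : ∀ k n → n ≤ k → D k n ≡ 0ℤ
        D-limit k n n≤k = cong₂ ℤ._+_ (shift-≡0 (β (suc k) (suc k) 1) (n<e 2))
                                    (shift-≡0 (β (suc (suc k)) (suc (suc k)) 1) (n<e 3))
          where
          n<e : ∀ j → n < 2 * k + suc j
          n<e j = ≤-<-trans (≤-trans n≤k (m≤m+n k (k + 0))) (m<m+n (2 * k) (s≤s z≤n))

        -- Downward induction on `k`, with `d` bounding the distance to the degree bound `N`. Once
        -- `k ≥ N` both sides equal their limits. Keeping `N` fixed makes every degree up to `N`
        -- available at `k + 1` and `k + 2`, as the shifts in `C-step` require.
        descend : ∀ d k n {N} → n ≤ N → N ≤ d + k → A k n ≡ β (suc k) k 0 n × C (suc k) n ≡ D k n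
        descend zero k n n≤N N≤k =
            trans (A-limit k n n≤k)
              (sym (β-limit k (suc k) k 0 n n≤k n≤k (n≤1+n k)))
          , trans (C-limit (suc k) n (m≤n⇒m≤1+n n≤k)) (sym (D-limit k n n≤k))
          where n≤k = ≤-trans n≤N N≤k
        descend (suc d) k n {N} n≤N N≤d+k = A-eq , C-eq
          where
          N≤d+1+k : N ≤ d + suc k
          N≤d+1+k = subst (N ≤_) (sym (+-suc d k)) N≤d+k
          next : ∀ i → i ≤ N → A (suc k) i ≡ β (suc (suc k)) (suc k) 0 i × C (suc (suc k)) i ≡ D (suc k) i
          next i i≤N = descend d (suc k) i i≤N N≤d+1+k
          next₂ : ∀ i → i ≤ N → A (suc (suc k)) i ≡ β (suc (suc (suc k))) (suc (suc k)) 0 i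
          next₂ i i≤N = proj₁ (descend d (suc (suc k)) i i≤N
            (≤-trans N≤d+1+k (+-monoʳ-≤ d (n≤1+n (suc k)))))
          i≤N : ∀ {e} i → i + e ≡ n → i ≤ N
          i≤N i p = ≤-trans (m+n≤o⇒m≤o i (≤-reflexive p)) n≤N
          C-eq : C (suc k) n ≡ D k n
          C-eq = trans (C-step (suc k) n) (trans
            (cong₂ ℤ._+_ (proj₂ (next n n≤N)) (cong₂ ℤ._+_
              (shift-cong (2 * suc k + 1) n λ i p → proj₁ (next i (i≤N i p)))
              (shift-cong (2 * suc k + 2) n λ i p → next₂ i (i≤N i p))))
            (sym (D-step k n)))
          A-eq : A k n ≡ β (suc k) k 0 n
          A-eq = trans (A-step k n) (trans
            (cong₂ ℤ._+_ (proj₁ (next n n≤N)) C-eq)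
            (sym (β-diagonal-step k n)))

-- Sums over partitions

insert : ℕ → List ℕ → List ℕ
insert c []      = c ∷ []
insert c (a ∷ π) with a ≤? c
... | yes _ = c ∷ a ∷ π
... | no  _ = a ∷ insert c π

remove : ℕ → List ℕ → List ℕ
remove c []      = []
remove c (a ∷ π) with a ≟ c
... | yes _ = π
... | no  _ = a ∷ remove c π

insert-↭ : ∀ c π → insert c π ↭ c ∷ π
insert-↭ c []      = ↭-refl
insert-↭ c (a ∷ π) with a ≤? c
... | yes _ = ↭-refl
... | no  _ = ↭-trans (prep a (insert-↭ c π)) (swap a c ↭-refl)

remove-insert : ∀ c π → remove c (insert c π) ≡ π
remove-insert c []      with c ≟ c
... | yes _   = refl
... | no  c≢c = contradiction refl c≢c
remove-insert c (a ∷ π) with a ≤? c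
... | yes _ with c ≟ c
...   | yes _   = refl
...   | no  c≢c = contradiction refl c≢c
remove-insert c (a ∷ π) | no a≰c with a ≟ c
...   | yes a≡c = contradiction (≤-reflexive a≡c) a≰c
...   | no  _   = cong (a ∷_) (remove-insert c π)

insert-injective : ∀ c {π ρ} → insert c π ≡ insert c ρ → π ≡ ρ
insert-injective c {π} {ρ} e =
  trans (sym (remove-insert c π)) (trans (cong (remove c) e) (remove-insert c ρ))

insert-remove : ∀ c {π} → AllPairs _≥_ π → c ∈ π → insert c (remove c π) ≡ π
insert-remove c {a ∷ π} (a≥π ∷ _) c∈ with a ≟ c
insert-remove c {a ∷ []}    (a≥π ∷ _) c∈ | yes refl = refl
insert-remove c {a ∷ b ∷ π} ((a≥b ∷ _) ∷ _) c∈ | yes refl with b ≤? a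
... | yes _   = refl
... | no  b≰a = contradiction a≥b b≰a
insert-remove c {a ∷ π} (a≥π ∷ ps) (here refl)  | no a≢c = contradiction refl a≢c
insert-remove c {a ∷ π} (a≥π ∷ ps) (there c∈π) | no a≢c with a ≤? c
... | yes a≤c = contradiction (≤-antisym a≤c (All.lookup a≥π c∈π)) a≢c
... | no  _   = cong (a ∷_) (insert-remove c ps c∈π)

insert-All : ∀ {P : ℕ → Set} {c π} → P c → All P π → All P (insert c π)
insert-All {c = c} {π} p ps = All-resp-↭ (↭-sym (insert-↭ c π)) (p ∷ ps)

remove-All : ∀ {P : ℕ → Set} c {π} → All P π → All P (remove c π)
remove-All c {[]}    []       = []
remove-All c {a ∷ π} (p ∷ ps) with a ≟ c
... | yes _ = ps
... | no  _ = p ∷ remove-All c ps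

insert-sorted : ∀ c {π} → AllPairs _≥_ π → AllPairs _≥_ (insert c π)
insert-sorted c {[]}    []         = [] ∷ []
insert-sorted c {a ∷ π} (a≥π ∷ ps) with a ≤? c
... | yes a≤c = (a≤c ∷ All.map (λ b≤a → ≤-trans b≤a a≤c) a≥π) ∷ a≥π ∷ ps
... | no  a≰c = insert-All (<⇒≤ (≰⇒> a≰c)) a≥π ∷ insert-sorted c ps

remove-sorted : ∀ c {π} → AllPairs _≥_ π → AllPairs _≥_ (remove c π)
remove-sorted c {[]}    []         = []
remove-sorted c {a ∷ π} (a≥π ∷ ps) with a ≟ c
... | yes _ = ps
... | no  _ = remove-All c a≥π ∷ remove-sorted c ps

sorted : ∀ {π} → IsPartition π → AllPairs _≥_ π
sorted p = Linked⇒AllPairs (λ i≥j j≥k → ≤-trans j≥k i≥j) (IsPartition.nonIncreasing p)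

insert-isPartition : ∀ {c π} → 0 < c → IsPartition π → IsPartition (insert c π)
insert-isPartition {c} 0<c p = mkIsPartition
  (insert-All 0<c (IsPartition.positive p)) (AllPairs⇒Linked (insert-sorted c (sorted p)))

remove-isPartition : ∀ c {π} → IsPartition π → IsPartition (remove c π)
remove-isPartition c p = mkIsPartition
  (remove-All c (IsPartition.positive p)) (AllPairs⇒Linked (remove-sorted c (sorted p)))

∈-insert⁺ˡ : ∀ c π → c ∈ insert c π
∈-insert⁺ˡ c π = ∈-resp-↭ (↭-sym (insert-↭ c π)) (here refl)

∈-insert⁺ʳ : ∀ {c π x} → x ∈ π → x ∈ insert c π
∈-insert⁺ʳ {c} {π} p = ∈-resp-↭ (↭-sym (insert-↭ c π)) (there p)

∈-insert⁻ : ∀ {c π x} → x ∈ insert c π → x ≡ c ⊎ x ∈ π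
∈-insert⁻ {c} {π} p with ∈-resp-↭ (insert-↭ c π) p
... | here e  = inj₁ e
... | there q = inj₂ q

sum-insert : ∀ c π → sum (insert c π) ≡ c + sum π
sum-insert c π = sum-↭ (insert-↭ c π)

freq-insert-≡ : ∀ c π → freq c (insert c π) ≡ suc (freq c π)
freq-insert-≡ c π = trans (↭-length (filter-↭ (c ≟_) (insert-↭ c π)))
  (cong length (filter-accept (c ≟_) refl))

freq-insert-≢ : ∀ {i c} π → i ≢ c → freq i (insert c π) ≡ freq i π
freq-insert-≢ {i} {c} π i≢c = trans (↭-length (filter-↭ (i ≟_) (insert-↭ c π)))
  (cong length (filter-reject (i ≟_) i≢c))

-- The statistics are natural numbers; the total is cast to ℤ for comparison with the alternating
-- sums `β`.
partitionSum : (List ℕ → ℕ) → Series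
partitionSum F n = ℤ.+ sum (map F (partitions n))

∈-partitions⁻ : ∀ {π n} → π ∈ partitions n → IsPartition π × sum π ≡ n
∈-partitions⁻ = Equivalence.to ∈-partitions

∈-partitions⁺ : ∀ {π n} → IsPartition π → sum π ≡ n → π ∈ partitions n
∈-partitions⁺ p e = Equivalence.from ∈-partitions (p , e)

module _ {A : Set} where

  sum-map-cong : ∀ {F G : A → ℕ} xs → (∀ {x} → x ∈ xs → F x ≡ G x) →
                 sum (map F xs) ≡ sum (map G xs)
  sum-map-cong []       h = refl
  sum-map-cong (x ∷ xs) h = cong₂ _+_ (h (here refl)) (sum-map-cong xs (h ∘ there))

  sum-map-+ : ∀ (F G : A → ℕ) xs → sum (map (λ x → F x + G x) xs) ≡ sum (map F xs) + sum (map G xs)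
  sum-map-+ F G []       = refl
  sum-map-+ F G (x ∷ xs) =
    trans (cong (F x + G x +_) (sum-map-+ F G xs)) (interchange (F x) (G x) _ _)

  sum-map-0 : ∀ {F : A → ℕ} xs → (∀ {x} → x ∈ xs → F x ≡ 0) → sum (map F xs) ≡ 0
  sum-map-0 []       h = refl
  sum-map-0 (x ∷ xs) h = cong₂ _+_ (h (here refl)) (sum-map-0 xs (h ∘ there))

  sum-map-filter : ∀ {F : A → ℕ} {P : A → Set} (P? : ∀ x → Dec (P x)) xs →
                   (∀ {x} → x ∈ xs → ¬ P x → F x ≡ 0) → sum (map F xs) ≡ sum (map F (filter P? xs))
  sum-map-filter P? []       h = refl
  sum-map-filter {F} P? (x ∷ xs) h with P? x
  ... | yes _  = cong (F x +_) (sum-map-filter P? xs (h ∘ there))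
  ... | no  ¬p = cong₂ _+_ (h (here refl) ¬p) (sum-map-filter P? xs (h ∘ there))

partitionSum-cong : ∀ {F G} n → (∀ {π} → IsPartition π → sum π ≡ n → F π ≡ G π) →
                    partitionSum F n ≡ partitionSum G n
partitionSum-cong n h = cong ℤ.+_ (sum-map-cong (partitions n)
  λ p → let (q , e) = ∈-partitions⁻ p in h q e)

partitionSum-+ : ∀ {F G H} n → (∀ {π} → IsPartition π → F π ≡ G π + H π) →
                 partitionSum F n ≡ partitionSum G n ℤ.+ partitionSum H n
partitionSum-+ {F} {G} {H} n h =
  trans (partitionSum-cong n λ p _ → h p) (cong ℤ.+_ (sum-map-+ G H (partitions n)))

partitionSum-0 : ∀ {F} n → (∀ {π} → IsPartition π → sum π ≡ n → F π ≡ 0) → partitionSum F n ≡ 0ℤ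
partitionSum-0 n h = cong ℤ.+_ (sum-map-0 (partitions n)
  λ p → let (q , e) = ∈-partitions⁻ p in h q e)

-- Deleting one copy of `suc c` inverts its insertion, so both lists have the same members; as
-- neither repeats a member, they are permutations of each other.
partitionsWith-↭ : ∀ c n →
  filter (suc c ∈?_) (partitions (suc c + n)) ↭ map (insert (suc c)) (partitions n)
partitionsWith-↭ c n = ∼bag⇒↭ (unique∧set⇒bag
  (Unique.filter⁺ (suc c ∈?_) (partitions-unique (suc c + n)))
  (Unique.map⁺ (insert-injective (suc c)) (partitions-unique n))
  (mk⇔ to from))
  where
  to : ∀ {π} → π ∈ filter (suc c ∈?_) (partitions (suc c + n)) →
       π ∈ map (insert (suc c)) (partitions n)
  to {π} p with (q , c∈π) ← ∈-filter⁻ (suc c ∈?_) {xs = partitions (suc c + n)} p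
           with (isP , e) ← ∈-partitions⁻ q =
    subst (_∈ map (insert (suc c)) (partitions n)) same
      (∈-map⁺ (insert (suc c)) (∈-partitions⁺ (remove-isPartition (suc c) isP) size))
    where
    same = insert-remove (suc c) (sorted isP) c∈π
    size : sum (remove (suc c) π) ≡ n
    size = +-cancelˡ-≡ (suc c) _ _
      (trans (sym (sum-insert (suc c) (remove (suc c) π))) (trans (cong sum same) e))

  from : ∀ {π} → π ∈ map (insert (suc c)) (partitions n) →
         π ∈ filter (suc c ∈?_) (partitions (suc c + n))
  from p with (ρ , q , refl) ← ∈-map⁻ (insert (suc c)) p with (isP , e) ← ∈-partitions⁻ q =
    ∈-filter⁺ (suc c ∈?_)
      (∈-partitions⁺ (insert-isPartition (s≤s z≤n) isP) (trans (sum-insert (suc c) ρ) (cong (suc c +_) e)))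
      (∈-insert⁺ˡ (suc c) ρ)

shift-+ˡ : ∀ f c n → shift c f (c + n) ≡ f n
shift-+ˡ f zero    n = refl
shift-+ˡ f (suc c) n = shift-+ˡ f c n

-- Only partitions containing `c` contribute to `F`, and removing one copy of `c` lowers the degree
-- by `c`. All the shifts in the combinatorial recurrences come from here.
partitionSum-insert : ∀ {F G} c n → 0 < c →
  (∀ {π} → IsPartition π → c ∉ π → F π ≡ 0) →
  (∀ {π} → IsPartition π → F (insert c π) ≡ G π) →
  partitionSum F n ≡ shift c (partitionSum G) n
partitionSum-insert {F} {G} (suc c) n _ absent present with suc c ≤? n
-- No partition of `n` has a part larger than `n`, so both sides are 0.
... | no c≰n = trans
  (partitionSum-0 n λ p e → absent p λ c∈π → c≰n (subst (suc c ≤_) e (∈⇒≤sum c∈π)))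
  (sym (shift-≡0 _ (≰⇒> c≰n)))
... | yes c≤n = subst (λ i → partitionSum F i ≡ shift (suc c) (partitionSum G) i) (m+[n∸m]≡n c≤n) (begin
  partitionSum F (suc c + m)
    ≡⟨ cong ℤ.+_ (sum-map-filter (suc c ∈?_) (partitions (suc c + m))
         λ p → absent (proj₁ (∈-partitions⁻ {n = suc c + m} p))) ⟩
  ℤ.+ sum (map F (filter (suc c ∈?_) (partitions (suc c + m))))
    ≡⟨ cong ℤ.+_ (sum-↭ (map⁺ F (partitionsWith-↭ c m))) ⟩
  ℤ.+ sum (map F (map (insert (suc c)) (partitions m)))
    ≡⟨ cong ℤ.+_ (cong sum (sym (map-∘ (partitions m)))) ⟩
  partitionSum (F ∘ insert (suc c)) m
    ≡⟨ partitionSum-cong m (λ p _ → present p) ⟩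
  partitionSum G m
    ≡⟨ shift-+ˡ _ (suc c) m ⟨
  shift (suc c) (partitionSum G) (suc c + m) ∎)
  where
  open ≡-Reasoning
  m = n ∸ suc c

-- The weights

indicator : ∀ {P : Set} → Dec P → ℕ
indicator (yes _) = 1
indicator (no  _) = 0

indicator-yes : ∀ {P : Set} (P? : Dec P) → P → indicator P? ≡ 1
indicator-yes (yes _) p = refl
indicator-yes (no ¬p) p = contradiction p ¬p

indicator-no : ∀ {P : Set} (P? : Dec P) → ¬ P → indicator P? ≡ 0
indicator-no (yes p) ¬p = contradiction p ¬p
indicator-no (no  _) ¬p = refl

indicator-cong : ∀ {P Q : Set} (P? : Dec P) (Q? : Dec Q) →
  (P → Q) → (Q → P) → indicator P? ≡ indicator Q?
indicator-cong P? (yes q) f g = indicator-yes P? (g q)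
indicator-cong P? (no ¬q) f g = indicator-no P? (¬q ∘ f)

indicator-⊎ : ∀ {P Q R : Set} (P? : Dec P) (Q? : Dec Q) (R? : Dec R) →
  (P → Q ⊎ R) → (Q → P) → (R → P) → ¬ (Q × R) → indicator P? ≡ indicator Q? + indicator R?
indicator-⊎ P? (yes q) (yes r) f g h d = contradiction (q , r) d
indicator-⊎ P? (yes q) (no ¬r) f g h d = indicator-yes P? (g q)
indicator-⊎ P? (no ¬q) (yes r) f g h d = indicator-yes P? (h r)
indicator-⊎ P? (no ¬q) (no ¬r) f g h d = indicator-no P? ([ ¬q , ¬r ]′ ∘ f)

-- For a > b, this is the number of even integers strictly between b and a.
evensBetween : ℕ → ℕ → ℕ
evensBetween a b = ⌊ a ∸ 1 /2⌋ ∸ ⌊ b /2⌋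

⌊2*k/2⌋ : ∀ k → ⌊ 2 * k /2⌋ ≡ k
⌊2*k/2⌋ k = trans (cong (λ x → ⌊ k + x /2⌋) (+-identityʳ k)) (sym (n≡⌊n+n/2⌋ k))

⌊2*k+1/2⌋ : ∀ k → ⌊ 2 * k + 1 /2⌋ ≡ k
⌊2*k+1/2⌋ k = trans (cong ⌊_/2⌋ (trans (+-comm (2 * k) 1) (cong (λ x → suc (k + x)) (+-identityʳ k))))
  (sym (n≡⌈n+n/2⌉ k))

evensBetween≡0 : ∀ {a b} → a ≤ b → evensBetween a b ≡ 0
evensBetween≡0 {a} {b} a≤b = m≤n⇒m∸n≡0 (⌊n/2⌋-mono (≤-trans (m∸n≤m a 1) a≤b))

evensBetween-2k+1 : ∀ a k → evensBetween a (2 * k + 1) ≡ evensBetween a (2 * k)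
evensBetween-2k+1 a k = cong (⌊ a ∸ 1 /2⌋ ∸_) (trans (⌊2*k+1/2⌋ k) (sym (⌊2*k/2⌋ k)))

2*-suc : ∀ k → 2 * suc k ≡ 2 * k + 2
2*-suc k = trans (*-suc 2 k) (+-comm 2 (2 * k))

-- Moving the lower end from 2k to 2k+2 loses only the even integer 2k+2, which is counted exactly
-- when it lies below `a`.
evensBetween-step : ∀ a k →
  evensBetween a (2 * k) ≡ evensBetween a (2 * suc k) + indicator (2 * suc k <? a)
evensBetween-step a k with 2 * suc k <? a
... | yes 2k+2<a = begin
  ⌊ a ∸ 1 /2⌋ ∸ ⌊ 2 * k /2⌋                ≡⟨ cong (⌊ a ∸ 1 /2⌋ ∸_) (⌊2*k/2⌋ k) ⟩
  ⌊ a ∸ 1 /2⌋ ∸ k                         ≡⟨ ∸-suc k<h ⟩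
  suc (⌊ a ∸ 1 /2⌋ ∸ suc k)               ≡⟨ +-comm 1 _ ⟩
  ⌊ a ∸ 1 /2⌋ ∸ suc k + 1                 ≡⟨ cong (λ x → ⌊ a ∸ 1 /2⌋ ∸ x + 1) (⌊2*k/2⌋ (suc k)) ⟨
  ⌊ a ∸ 1 /2⌋ ∸ ⌊ 2 * suc k /2⌋ + 1        ∎
  where
  open ≡-Reasoning
  k<h : suc k ≤ ⌊ a ∸ 1 /2⌋
  k<h = subst (_≤ ⌊ a ∸ 1 /2⌋) (⌊2*k/2⌋ (suc k)) (⌊n/2⌋-mono (∸-monoˡ-≤ 1 2k+2<a))
  ∸-suc : ∀ {x k} → suc k ≤ x → x ∸ k ≡ suc (x ∸ suc k)
  ∸-suc {suc x} {k} (s≤s k≤x) = +-∸-assoc 1 k≤x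
... | no  2k+2≮a = trans (m≤n⇒m∸n≡0 h≤k) (sym (trans (+-identityʳ _) (evensBetween≡0 (≮⇒≥ 2k+2≮a))))
  where
  a∸1≤ : a ∸ 1 ≤ 2 * k + 1
  a∸1≤ = ≤-trans (∸-monoˡ-≤ 1 (≮⇒≥ 2k+2≮a))
    (≤-reflexive (trans (cong (_∸ 1) (2*-suc k)) (+-∸-assoc (2 * k) (s≤s z≤n))))
  h≤k : ⌊ a ∸ 1 /2⌋ ≤ ⌊ 2 * k /2⌋
  h≤k = ≤-trans (⌊n/2⌋-mono a∸1≤) (≤-reflexive (trans (⌊2*k+1/2⌋ k) (sym (⌊2*k/2⌋ k))))

-- The factor `t` of the last part is left free, so identities between the statistics below reduce
-- to identities between their values of `t`. The empty partition gets 0, since it has no last part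
-- to lie above or at a bound.
chain : (ℕ → ℕ) → List ℕ → ℕ
chain t []          = 0
chain t (a ∷ [])    = t a
chain t (a ∷ b ∷ π) = evensBetween a b * chain t (b ∷ π)

chain-cong : ∀ {s t} π → (∀ a → s a ≡ t a) → chain s π ≡ chain t π
chain-cong []          h = refl
chain-cong (a ∷ [])    h = h a
chain-cong (a ∷ b ∷ π) h = cong (evensBetween a b *_) (chain-cong (b ∷ π) h)

chain-+ : ∀ s t π → chain (λ a → s a + t a) π ≡ chain s π + chain t π
chain-+ s t []          = refl
chain-+ s t (a ∷ [])    = refl
chain-+ s t (a ∷ b ∷ π) = trans (cong (evensBetween a b *_) (chain-+ s t (b ∷ π)))
  (*-distribˡ-+ (evensBetween a b) _ _)

chain-0 : ∀ {t π} → (∀ {a} → a ∈ π → t a ≡ 0) → chain t π ≡ 0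
chain-0 {π = []}        h = refl
chain-0 {π = a ∷ []}    h = h (here refl)
chain-0 {π = a ∷ b ∷ π} h = trans (cong (evensBetween a b *_) (chain-0 {π = b ∷ π} (h ∘ there)))
  (*-zeroʳ (evensBetween a b))

-- The weight ω₂ with the convention λ_{ν(π)+1} = 0 replaced by λ_{ν(π)+1} = c.
weight : ℕ → List ℕ → ℕ
weight c []        = 1
weight c (a ∷ π) = chain (λ x → evensBetween x c) (a ∷ π)

endsAbove endsAt : ℕ → List ℕ → ℕ
endsAbove c = chain λ a → indicator (c <? a)
endsAt    c = chain λ a → indicator (a ≟ c)

weight-step : ∀ k π → weight (2 * k) π ≡ weight (2 * suc k) π + endsAbove (2 * suc k) π
weight-step k []      = refl
weight-step k (a ∷ π) = trans (chain-cong (a ∷ π) λ x → evensBetween-step x k) (chain-+ _ _ (a ∷ π))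

endsAbove-step : ∀ c π → endsAbove c π ≡ endsAbove (suc c) π + endsAt (suc c) π
endsAbove-step c π = trans
  (chain-cong π λ a → indicator-⊎ (c <? a) (suc c <? a) (a ≟ suc c)
    (split a) (<-trans (n<1+n c)) (λ e → ≤-reflexive (sym e)) λ (lt , e) → <-irrefl (sym e) lt)
  (chain-+ _ _ π)
  where
  split : ∀ a → suc c ≤ a → suc (suc c) ≤ a ⊎ a ≡ suc c
  split a c<a with m≤n⇒m<n∨m≡n c<a
  ... | inj₁ lt = inj₁ lt
  ... | inj₂ e  = inj₂ (sym e)

weight-2k+1 : ∀ k π → weight (2 * k + 1) π ≡ weight (2 * k) π
weight-2k+1 k []      = refl
weight-2k+1 k (a ∷ π) = chain-cong (a ∷ π) λ x → evensBetween-2k+1 x k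

endsAt-∉ : ∀ {c π} → c ∉ π → endsAt c π ≡ 0
endsAt-∉ {c} {π} c∉π = chain-0 {π = π} λ {a} a∈π → indicator-no (a ≟ c) λ { refl → c∉π a∈π }

weight≡0 : ∀ {c a π} → All (_≤ c) (a ∷ π) → weight c (a ∷ π) ≡ 0
weight≡0 {π = π} ps = chain-0 λ x∈ → evensBetween≡0 (All.lookup ps x∈)

-- If all parts exceed `c`, the new part comes last and contributes the final factor of `weight c`.
-- Otherwise both sides vanish, since inserting `c` leaves a smaller last part or a repeated `c`,
-- and `evensBetween c c` is 0.
endsAt-insert : ∀ c {π} → AllPairs _≥_ π → endsAt c (insert c π) ≡ weight c π
endsAt-insert c {[]}    []         = indicator-yes (c ≟ c) refl
endsAt-insert c {a ∷ π} (a≥π ∷ ps) with a ≤? c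
... | yes a≤c = trans below (sym (weight≡0 {c} (a≤c ∷ All.map (λ b≤a → ≤-trans b≤a a≤c) a≥π)))
  where
  below : evensBetween c a * endsAt c (a ∷ π) ≡ 0
  below with a ≟ c
  ... | yes refl = cong (_* endsAt c (a ∷ π)) (evensBetween≡0 (≤-refl {a}))
  ... | no  a≢c  = trans (cong (evensBetween c a *_) (endsAt-∉ {c} {a ∷ π} c∉)) (*-zeroʳ (evensBetween c a))
    where
    c∉ : c ∉ a ∷ π
    c∉ (here refl) = a≢c refl
    c∉ (there c∈π) = a≢c (≤-antisym a≤c (All.lookup a≥π c∈π))
endsAt-insert c {a ∷ []}    (a≥π ∷ ps) | no a≰c =
  trans (cong (evensBetween a c *_) (indicator-yes (c ≟ c) refl)) (*-identityʳ _)
endsAt-insert c {a ∷ b ∷ π} (a≥π ∷ ps@(b≥π ∷ _)) | no a≰c with b ≤? c | endsAt-insert c {b ∷ π} ps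
... | no  b≰c | ih = cong (evensBetween a b *_) ih
-- Here `c` lands between `a` and `b`, and each side contains a factor equal to `weight c (b ∷ π)`,
-- which is 0.
... | yes b≤c | ih = trans
  (trans (cong (evensBetween a c *_) (trans ih zeroWeight)) (*-zeroʳ (evensBetween a c)))
  (sym (trans (cong (evensBetween a b *_) zeroWeight) (*-zeroʳ (evensBetween a b))))
  where
  zeroWeight : weight c (b ∷ π) ≡ 0
  zeroWeight = weight≡0 (b≤c ∷ All.map (λ x≤b → ≤-trans x≤b b≤c) b≥π)

-- The series A k and C k of the recurrences.
weightSeries endsAboveSeries : ℕ → Series
weightSeries k = partitionSum (weight (2 * k))
endsAboveSeries k = partitionSum (endsAbove (2 * k))

weightSeries-step : ∀ k n → weightSeries k n ≡ weightSeries (suc k) n ℤ.+ endsAboveSeries (suc k) n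
weightSeries-step k n = partitionSum-+ n λ {π} _ → weight-step k π

endsAt-series : ∀ c n → partitionSum (endsAt (suc c)) n ≡ shift (suc c) (partitionSum (weight (suc c))) n
endsAt-series c n = partitionSum-insert (suc c) n (s≤s z≤n) (λ {π} _ → endsAt-∉ {suc c} {π})
  λ p → endsAt-insert (suc c) (sorted p)

-- The bound is raised past 2k+1 and then past 2k+2. A last part equal to one of these is removed
-- and becomes the new terminal value of the weight; the terminal values 2k+1 and 2k give the same
-- weight.
endsAboveSeries-step : ∀ k n → endsAboveSeries k n ≡ endsAboveSeries (suc k) n
  ℤ.+ (shift (2 * k + 1) (weightSeries k) n ℤ.+ shift (2 * k + 2) (weightSeries (suc k)) n)
endsAboveSeries-step k n = begin
  endsAboveSeries k n
    ≡⟨ partitionSum-+ n (λ {π} _ → endsAbove-step (2 * k) π) ⟩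
  partitionSum (endsAbove (suc (2 * k))) n ℤ.+ x
    ≡⟨ cong (ℤ._+ x) (partitionSum-+ n (λ {π} _ → endsAbove-step (suc (2 * k)) π)) ⟩
  (partitionSum (endsAbove (suc (suc (2 * k)))) n ℤ.+ y) ℤ.+ x
    ≡⟨ ℤ.+-assoc (partitionSum (endsAbove (suc (suc (2 * k)))) n) y x ⟩
  partitionSum (endsAbove (suc (suc (2 * k)))) n ℤ.+ (y ℤ.+ x)
    ≡⟨ cong₂ ℤ._+_ (cong (λ c → partitionSum (endsAbove c) n) (sym (*-suc 2 k)))
         (trans (ℤ.+-comm y x) (cong₂ ℤ._+_ oddEnd evenEnd)) ⟩
  endsAboveSeries (suc k) n
    ℤ.+ (shift (2 * k + 1) (weightSeries k) n ℤ.+ shift (2 * k + 2) (weightSeries (suc k)) n) ∎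
  where
  open ≡-Reasoning
  x = partitionSum (endsAt (suc (2 * k))) n
  y = partitionSum (endsAt (suc (suc (2 * k)))) n
  oddEnd : x ≡ shift (2 * k + 1) (weightSeries k) n
  oddEnd = trans (endsAt-series (2 * k) n) (trans (shift-exponent n (+-comm 1 (2 * k)))
    (shift-cong (2 * k + 1) n λ i _ → partitionSum-cong i λ {π} _ _ →
      trans (cong (λ c → weight c π) (+-comm 1 (2 * k))) (weight-2k+1 k π)))
  evenEnd : y ≡ shift (2 * k + 2) (weightSeries (suc k)) n
  evenEnd = trans (endsAt-series (suc (2 * k)) n) (trans (shift-exponent n (+-comm 2 (2 * k)))
    (shift-cong (2 * k + 2) n λ i _ → partitionSum-cong i λ {π} _ _ →
      cong (λ c → weight c π) (sym (*-suc 2 k))))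

parts≤ : ∀ {k n π} → n ≤ k → sum π ≡ n → All (_≤ 2 * k) π
parts≤ {k} {n} {π} n≤k e = All.tabulate λ x∈π →
  ≤-trans (∈⇒≤sum x∈π) (≤-trans (≤-reflexive e) (≤-trans n≤k (m≤m+n k (k + 0))))

endsAboveSeries-limit : ∀ k n → n ≤ k → endsAboveSeries k n ≡ 0ℤ
endsAboveSeries-limit k n n≤k = partitionSum-0 n λ {π} _ e → chain-0 {π = π} λ {a} a∈π →
  indicator-no (2 * k <? a) (≤⇒≯ (All.lookup (parts≤ n≤k e) a∈π))

-- The partitions in Prdo

∈⇒freq>0 : ∀ {x π} → x ∈ π → 1 ≤ freq x π
∈⇒freq>0 {x} {π} x∈π with filter (x ≟_) π | ∈-filter⁺ (x ≟_) x∈π refl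
... | _ ∷ _ | _ = s≤s z≤n

∉⇒freq≡0 : ∀ {x π} → x ∉ π → freq x π ≡ 0
∉⇒freq≡0 {x} {π} x∉π with freq x π in eq
... | zero  = refl
... | suc _ = contradiction (freq>0⇒∈ x π (subst (1 ≤_) (sym eq) (s≤s z≤n))) x∉π

freq≡0⇒∉ : ∀ {x π} → freq x π ≡ 0 → x ∉ π
freq≡0⇒∉ e x∈π with () ← subst (1 ≤_) e (∈⇒freq>0 x∈π)

even-2k+2 : ∀ k → Even (2 * k + 2)
even-2k+2 k = ∣m∣n⇒∣m+n (m∣m*n k) (m∣m*n 1)

odd-2k+3 : ∀ k → Odd (2 * k + 3)
odd-2k+3 k e = from-no (2 ∣? 3) (∣m+n∣m⇒∣n e (m∣m*n k))

2k+2≢ : ∀ {i} k → Odd i → i ≢ 2 * k + 2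
2k+2≢ k odd refl = odd (even-2k+2 k)

≤2k+2⇒≤2k+1 : ∀ {i} k → Odd i → i ≤ 2 * k + 2 → i ≤ 2 * k + 1
≤2k+2⇒≤2k+1 {i} k odd i≤ = s≤s⁻¹ (≤-trans (≤∧≢⇒< i≤ (2k+2≢ k odd)) (≤-reflexive (+-suc (2 * k) 1)))

next-odd≤ : ∀ {i} k → Odd i → 2 * k + 3 ≤ i → i ≢ 2 * k + 3 → 2 * suc k + 3 ≤ i
next-odd≤ {i} k odd ≤i ≢i = ≤-trans (≤-reflexive (+-suc (2 * suc k) 2))
  (≤∧≢⇒< (≤-trans (≤-reflexive (shape k)) (≤∧≢⇒< ≤i (≢i ∘ sym))) (2k+2≢ (suc k) odd ∘ sym))
  where
  shape : ∀ k → 2 * suc k + 2 ≡ suc (2 * k + 3)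
  shape = ℕSolver.solve-∀

-- Bounded even parts, distinct odd parts, and their limits

EvensUpTo : ℕ → List ℕ → Set
EvensUpTo m = All λ x → Even x × x ≤ 2 * m

evensUpTo? : ∀ m π → Dec (EvensUpTo m π)
evensUpTo? m = All.all? λ x → 2 ∣? x ×-dec x ≤? 2 * m

-- This is 1/(q²;q²)ₘ, which serves as the series `c m` of the module `Heine`.
evenSeries : ℕ → Series
evenSeries m = partitionSum λ π → indicator (evensUpTo? m π)

evenSeries-step : ∀ m n →
  evenSeries (suc m) n ≡ evenSeries m n ℤ.+ shift (2 * m + 2) (evenSeries (suc m)) n
evenSeries-step m n = trans
  (partitionSum-+ n λ {π} _ → indicator-⊎ (evensUpTo? (suc m) π) (evensUpTo? m π) (with? π)
    split (All.map weaken) proj₁ λ (ps , _ , c∈π) → <⇒≱ 2m<c (proj₂ (All.lookup ps c∈π)))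
  (cong (ℤ._+_ (evenSeries m n)) (partitionSum-insert c n 0<c
    (λ {π} _ c∉π → indicator-no (with? π) (c∉π ∘ proj₂))
    λ {π} _ → indicator-cong (with? (insert c π)) (evensUpTo? (suc m) π)
      (λ (ps , _) → All.tabulate λ x∈π → All.lookup ps (∈-insert⁺ʳ x∈π))
      (λ ps → insert-All (even-2k+2 m , ≤-reflexive (sym (2*-suc m))) ps , ∈-insert⁺ˡ c π)))
  where
  c = 2 * m + 2
  with? : ∀ π → Dec (EvensUpTo (suc m) π × c ∈ π)
  with? π = evensUpTo? (suc m) π ×-dec c ∈? π
  2m<c : 2 * m < c
  2m<c = m<m+n (2 * m) (s≤s z≤n)
  0<c : 0 < c
  0<c = ≤-<-trans z≤n 2m<c
  weaken : ∀ {x} → Even x × x ≤ 2 * m → Even x × x ≤ 2 * suc m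
  weaken (e , x≤) = e , ≤-trans x≤ (*-monoʳ-≤ 2 (n≤1+n m))
  split : ∀ {π} → EvensUpTo (suc m) π → EvensUpTo m π ⊎ (EvensUpTo (suc m) π × c ∈ π)
  split {π} ps with c ∈? π
  ... | yes c∈π = inj₂ (ps , c∈π)
  ... | no  c∉π = inj₁ (All.tabulate λ {x} x∈π →
    let (e , x≤) = All.lookup ps x∈π in
    e , decidable-stable (x ≤? 2 * m) λ x≰ → c∉π (subst (_∈ π)
      (atTop x e (≤-trans x≤ (≤-reflexive (2*-suc m))) (≰⇒> x≰)) x∈π))
    where
    atTop : ∀ x → Even x → x ≤ c → 2 * m < x → x ≡ c
    atTop x e x≤c 2m<x = ≤-antisym x≤c (≤-trans (≤-reflexive (+-suc (2 * m) 1)) (≤∧≢⇒<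
      (≤-trans (≤-reflexive (+-comm (2 * m) 1)) 2m<x)
      λ { refl → from-no (2 ∣? 1) (∣m+n∣m⇒∣n e (m∣m*n m)) }))

-- All parts are at most 2k, so the last factor of the weight vanishes unless the partition is
-- empty; `evenSeries 0` likewise counts only the empty partition.
weightSeries-limit : ∀ k n → n ≤ k → weightSeries k n ≡ evenSeries 0 n
weightSeries-limit k n n≤k = partitionSum-cong n limit
  where
  limit : ∀ {π} → IsPartition π → sum π ≡ n → weight (2 * k) π ≡ indicator (evensUpTo? 0 π)
  limit {[]}    p e = sym (indicator-yes (evensUpTo? 0 []) [])
  limit {a ∷ π} p e = trans (weight≡0 (parts≤ {π = a ∷ π} n≤k e))
    (sym (indicator-no (evensUpTo? 0 (a ∷ π)) noParts))
    where
    noParts : ¬ EvensUpTo 0 (a ∷ π)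
    noParts ((_ , a≤0) ∷ _) with 0<a ∷ _ ← IsPartition.positive p = <⇒≱ 0<a a≤0

-- Even parts are unrestricted. The bound is 3 at `l = 0` because partitions in `Prdo` have no part
-- 1.
OddsDistinctFrom : ℕ → List ℕ → Set
OddsDistinctFrom l π = ∀ {x} → x ∈ π → Odd x → 2 * l + 3 ≤ x × freq x π ≤ 1

oddsDistinctFrom? : ∀ l π → Dec (OddsDistinctFrom l π)
oddsDistinctFrom? l π = map′ (λ ps {_} → All.lookup ps) (λ h → All.tabulate h)
  (All.all? (λ x → ¬? (2 ∣? x) →-dec (2 * l + 3 ≤? x ×-dec freq x π ≤? 1)) π)

oddsDistinctFrom-weaken : ∀ {l π} → OddsDistinctFrom (suc l) π → OddsDistinctFrom l π
oddsDistinctFrom-weaken {l} h x∈π odd = let (≤x , once) = h x∈π odd in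
  ≤-trans (+-monoˡ-≤ 3 (*-monoʳ-≤ 2 (n≤1+n l))) ≤x , once

oddsDistinctFrom-suc : ∀ {l π} → 2 * l + 3 ∉ π → OddsDistinctFrom l π → OddsDistinctFrom (suc l) π
oddsDistinctFrom-suc {l} c∉π h x∈π odd = let (≤x , once) = h x∈π odd in
  next-odd≤ l odd ≤x (λ { refl → c∉π x∈π }) , once

2l+3∉ : ∀ {l π} → OddsDistinctFrom (suc l) π → 2 * l + 3 ∉ π
2l+3∉ {l} h c∈π = <⇒≱ (+-monoˡ-< 3 (*-monoʳ-< 2 (n<1+n l))) (proj₁ (h c∈π (odd-2k+3 l)))

ω : ℕ → Series
ω l = partitionSum λ π → indicator (oddsDistinctFrom? l π)

-- Partitions are split by whether 2l+3 occurs. It occurs at most once, so removing it leaves only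
-- odd parts from 2l+5 on.
ω-step : ∀ l n → ω l n ≡ ω (suc l) n ℤ.+ shift (2 * l + 3) (ω (suc l)) n
ω-step l n = trans
  (partitionSum-+ n λ {π} _ → indicator-⊎ (oddsDistinctFrom? l π) (oddsDistinctFrom? (suc l) π) (with? π)
    (split π) oddsDistinctFrom-weaken proj₁ λ (h , _ , c∈π) → 2l+3∉ h c∈π)
  (cong (ℤ._+_ (ω (suc l) n)) (partitionSum-insert c n 0<c
    (λ {π} _ c∉π → indicator-no (with? π) (c∉π ∘ proj₂))
    λ {π} _ → indicator-cong (with? (insert c π)) (oddsDistinctFrom? (suc l) π)
      (λ (h , _) → delete h) (λ h → add h , ∈-insert⁺ˡ c π)))
  where
  c = 2 * l + 3
  0<c : 0 < c
  0<c = ≤-trans (s≤s z≤n) (m≤n+m 3 (2 * l))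
  with? : ∀ π → Dec (OddsDistinctFrom l π × c ∈ π)
  with? π = oddsDistinctFrom? l π ×-dec c ∈? π
  split : ∀ π → OddsDistinctFrom l π → OddsDistinctFrom (suc l) π ⊎ (OddsDistinctFrom l π × c ∈ π)
  split π h with c ∈? π
  ... | yes c∈π = inj₂ (h , c∈π)
  ... | no  c∉π = inj₁ (oddsDistinctFrom-suc c∉π h)
  delete : ∀ {π} → OddsDistinctFrom l (insert c π) → OddsDistinctFrom (suc l) π
  delete {π} h {x} x∈π odd = let (≤x , once) = h (∈-insert⁺ʳ x∈π) odd in
    next-odd≤ l odd ≤x (x≢c once) , subst (_≤ 1) (freq-insert-≢ π (x≢c once)) once
    where
    -- A copy of `c` left in `π` would make its frequency after insertion at least 2.
    x≢c : freq x (insert c π) ≤ 1 → x ≢ c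
    x≢c once refl = <⇒≱ (s≤s (∈⇒freq>0 x∈π)) (subst (_≤ 1) (freq-insert-≡ c π) once)
  add : ∀ {π} → OddsDistinctFrom (suc l) π → OddsDistinctFrom l (insert c π)
  add {π} h {x} x∈ odd with x ≟ c
  ... | yes refl = ≤-refl , ≤-reflexive (trans (freq-insert-≡ c π) (cong suc (∉⇒freq≡0 (2l+3∉ h))))
  ... | no  x≢c with ∈-insert⁻ x∈
  ...   | inj₁ e   = contradiction e x≢c
  ...   | inj₂ x∈π = let (≤x , once) = oddsDistinctFrom-weaken h x∈π odd in
    ≤x , subst (_≤ 1) (sym (freq-insert-≢ π x≢c)) once

-- In degree `n` no odd part as large as 2l+3 fits, and every part is automatically at most 2m.
ω-limit : ∀ l m n → n ≤ l → n ≤ m → ω l n ≡ evenSeries m n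
ω-limit l m n n≤l n≤m = partitionSum-cong n λ {π} _ e →
  indicator-cong (oddsDistinctFrom? l π) (evensUpTo? m π)
    (λ h → All.tabulate λ {x} x∈π →
        decidable-stable (2 ∣? x) (λ odd → <⇒≱ (2l+3> x∈π e) (proj₁ (h x∈π odd)))
      , All.lookup (parts≤ n≤m e) x∈π)
    (λ ps x∈π odd → contradiction (proj₁ (All.lookup ps x∈π)) odd)
  where
  2l+3> : ∀ {x π} → x ∈ π → sum π ≡ n → x < 2 * l + 3
  2l+3> x∈π e = ≤-<-trans (All.lookup (parts≤ n≤l e) x∈π) (m<m+n (2 * l) (s≤s z≤n))

-- Counting by the parity of the run of even parts

-- For a partition whose parts ≤ 2l+1 are exactly 2, 4, …, 2l (with repetitions),
-- Good says that an even number of further even parts 2l+2, 2l+4, … follows before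
-- the first one that is missing or is itself followed by the next odd number.
-- The first argument bounds the length of the search.
mutual
  Good : ℕ → ℕ → List ℕ → Set
  Good zero    l π = ⊤
  Good (suc f) l π = ¬ Bad f l π

  Bad : ℕ → ℕ → List ℕ → Set
  Bad f l π = 2 * l + 2 ∈ π × 2 * l + 3 ∉ π × Good f (suc l) π

mutual
  good? : ∀ f l π → Dec (Good f l π)
  good? zero    l π = yes tt
  good? (suc f) l π = ¬? (bad? f l π)

  bad? : ∀ f l π → Dec (Bad f l π)
  bad? f l π = 2 * l + 2 ∈? π ×-dec ¬? (2 * l + 3 ∈? π) ×-dec good? f (suc l) π

-- The search at level `l` inspects only parts from 2l+2 on. `Good` recurs under a negation, so the
-- hypothesis is an equivalence and its direction is swapped at each level.
good-cong : ∀ f l {π ρ} → (∀ {x} → 2 * l + 2 ≤ x → x ∈ π ⇔ x ∈ ρ) → Good f l π → Good f l ρ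
good-cong zero    l h _ = tt
good-cong (suc f) l h good (e , o , g) = good
  ( Equivalence.from (h ≤-refl) e
  , o ∘ Equivalence.to (h (+-monoʳ-≤ (2 * l) (n≤1+n 2)))
  , good-cong f (suc l) (λ ≤x → let eq = h (≤-trans (+-monoˡ-≤ 2 (*-monoʳ-≤ 2 (n≤1+n l))) ≤x) in
      mk⇔ (Equivalence.from eq) (Equivalence.to eq)) g)

goodSeries : ℕ → ℕ → Series
goodSeries f l = partitionSum λ π → indicator (oddsDistinctFrom? l π ×-dec good? f l π)

goodSeries-step : ∀ f l n → ω l n ≡ goodSeries (suc f) l n ℤ.+ shift (2 * l + 2) (goodSeries f (suc l)) n
goodSeries-step f l n = trans
  (partitionSum-+ n λ {π} _ → indicator-⊎ (oddsDistinctFrom? l π)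
    (oddsDistinctFrom? l π ×-dec good? (suc f) l π) (odds×bad? π)
    (split π) proj₁ proj₁ λ ((_ , good) , _ , bad) → good bad)
  (cong (ℤ._+_ (goodSeries (suc f) l n)) (partitionSum-insert c n 0<c
    (λ {π} _ c∉π → indicator-no (odds×bad? π) (c∉π ∘ proj₁ ∘ proj₂))
    λ {π} _ → indicator-cong (odds×bad? (insert c π)) (oddsDistinctFrom? (suc l) π ×-dec good? f (suc l) π)
      -- The absence of 2l+3 raises the bound on odd parts to level `suc l`, and the search from
      -- there on does not see the removed part 2l+2.
      (λ (h , _ , o , g) → oddsDistinctFrom-suc (o ∘ ∈-insert⁺ʳ) (delete h) , good-cong f (suc l) (same π) g)
      (λ (h , g) → add (oddsDistinctFrom-weaken h) , ∈-insert⁺ˡ c π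
        , (λ c+1∈ → 2l+3∉ h (∈-π (2k+2≢ l (odd-2k+3 l)) c+1∈))
        , good-cong f (suc l) (λ ≤x → let eq = same π ≤x in
            mk⇔ (Equivalence.from eq) (Equivalence.to eq)) g)))
  where
  c = 2 * l + 2
  0<c : 0 < c
  0<c = ≤-trans (s≤s z≤n) (m≤n+m 2 (2 * l))
  odds×bad? : ∀ π → Dec (OddsDistinctFrom l π × Bad f l π)
  odds×bad? π = oddsDistinctFrom? l π ×-dec bad? f l π
  split : ∀ π → OddsDistinctFrom l π →
          (OddsDistinctFrom l π × Good (suc f) l π) ⊎ (OddsDistinctFrom l π × Bad f l π)
  split π h with bad? f l π
  ... | yes bad = inj₂ (h , bad)
  ... | no good = inj₁ (h , good)
  ∈-π : ∀ {x π} → x ≢ c → x ∈ insert c π → x ∈ π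
  ∈-π x≢c x∈ with ∈-insert⁻ x∈
  ... | inj₁ e   = contradiction e x≢c
  ... | inj₂ x∈π = x∈π
  same : ∀ π {x} → 2 * suc l + 2 ≤ x → x ∈ insert c π ⇔ x ∈ π
  same π ≤x = mk⇔ (∈-π λ { refl → <⇒≱ (+-monoˡ-< 2 (*-monoʳ-< 2 (n<1+n l))) ≤x }) ∈-insert⁺ʳ
  delete : ∀ {π} → OddsDistinctFrom l (insert c π) → OddsDistinctFrom l π
  delete {π} h {x} x∈π odd = let (≤x , once) = h (∈-insert⁺ʳ x∈π) odd in
    ≤x , subst (_≤ 1) (freq-insert-≢ π (2k+2≢ l odd)) once
  add : ∀ {π} → OddsDistinctFrom l π → OddsDistinctFrom l (insert c π)
  add {π} h {x} x∈ odd = let (≤x , once) = h (∈-π (2k+2≢ l odd) x∈) odd in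
    ≤x , subst (_≤ 1) (sym (freq-insert-≢ π (2k+2≢ l odd))) once

open Heine ω

-- With `k = 0` and `m = l` the first Pascal rule is the recurrence `goodSeries-step`. Each level
-- lowers the degree by 2l+2, so a search bound `f ≥ n` suffices; in degree 0 there is nothing to
-- subtract.
goodSeries≡β : ∀ f l n → n ≤ f → goodSeries f l n ≡ β 1 l l n
goodSeries≡β zero l zero z≤n = trans
  (partitionSum-cong 0 λ {π} _ _ →
    indicator-cong (oddsDistinctFrom? l π ×-dec good? 0 l π) (oddsDistinctFrom? l π) proj₁ (_, tt))
  (sym (ℤ.+-identityʳ (ω l 0)))
goodSeries≡β (suc f) l n n≤f = begin
  goodSeries (suc f) l n
    ≡⟨ cancel (goodSeries (suc f) l n) s ⟩
  (goodSeries (suc f) l n ℤ.+ s) ℤ.- s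
    ≡⟨ cong (ℤ._- s) (goodSeries-step f l n) ⟨
  ω l n ℤ.- s
    ≡⟨ cong (λ x → ω l n ℤ.- x) (trans
         (shift-cong (2 * l + 2) n λ i e → goodSeries≡β f (suc l) i (i≤f i e))
         (shift-exponent n (+-comm (2 * l) 2))) ⟩
  ω l n ℤ.- shift (exponent 0 l) (β 1 (suc l) (suc l)) n
    ≡⟨ β-pascal 0 l l n ⟨
  β 1 l l n ∎
  where
  open ≡-Reasoning
  s = shift (2 * l + 2) (goodSeries f (suc l)) n
  cancel : ∀ x y → x ≡ (x ℤ.+ y) ℤ.- y
  cancel = ℤSolver.solve-∀
  i≤f : ∀ i → i + (2 * l + 2) ≡ n → i ≤ f
  i≤f i e = s≤s⁻¹ (≤-trans (i+c≡n⇒i<n (trans (cong (i +_) (sym (+-suc (2 * l) 1))) e)) n≤f)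

-- The diagonal `β (suc k) k 0` of the weights and the series `β 1 l l` of the count meet at
-- `k = l = 0`.
weightSeries≡goodSeries : ∀ n → weightSeries 0 n ≡ goodSeries n 0 n
weightSeries≡goodSeries n = trans
  (A≡β ω-step evenSeries evenSeries-step ω-limit
    weightSeries endsAboveSeries weightSeries-step endsAboveSeries-step
    weightSeries-limit endsAboveSeries-limit 0 n)
  (sym (goodSeries≡β n 0 n ≤-refl))

-- The run of even parts and the condition of `Prdo`

-- The parts ≤ 2r+1 are exactly 2, 4, …, 2r, and this run cannot be continued.
record StopsAt (r : ℕ) (π : List ℕ) : Set where
  constructor mkStopsAt
  field
    evens : ∀ i → 1 ≤ i → i ≤ r → 2 * i ∈ π
    odds  : ∀ i → Odd i → i ≤ 2 * r + 1 → i ∉ π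
    stop  : 2 * r + 2 ∉ π ⊎ (2 * r + 2 ∈ π × 2 * r + 3 ∈ π)

-- The run continues for 2d more even parts, and two levels of `Bad` cancel, so the induction takes
-- two levels at a time. At `d = 0` the field `stop` refutes `Bad`; `2 * d ≤ f` ensures that the
-- bound never cuts the search after an odd number of levels.
stopsAt⇒good : ∀ d f l {r π} → StopsAt r π → l + 2 * d ≡ r → 2 * d ≤ f → Good f l π
stopsAt⇒good d zero l s e d≤f = tt
stopsAt⇒good zero (suc f) l s e d≤f (c∈π , c+1∉π , _)
  with StopsAt.stop s | trans (sym (+-identityʳ l)) e
... | inj₁ c∉π         | refl = c∉π c∈π
... | inj₂ (_ , c+1∈π) | refl = c+1∉π c+1∈π
stopsAt⇒good (suc d) (suc zero) l s e d≤f with s≤s () ← ≤-trans (≤-reflexive (sym (*-suc 2 d))) d≤f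
stopsAt⇒good (suc d) (suc (suc f)) l {r} {π} s e d≤f (_ , _ , good) = good
  ( subst (_∈ π) (2*-suc (suc l)) (StopsAt.evens s (suc (suc l)) (s≤s z≤n) l+2≤r)
  , StopsAt.odds s (2 * suc l + 3) (odd-2k+3 (suc l))
      (≤-trans (≤-reflexive (shape l)) (+-monoˡ-≤ 1 (*-monoʳ-≤ 2 l+2≤r)))
  , stopsAt⇒good d f (suc (suc l)) s e′ (s≤s⁻¹ (s≤s⁻¹ (≤-trans (≤-reflexive (sym (*-suc 2 d))) d≤f))))
  where
  shape : ∀ l → 2 * suc l + 3 ≡ 2 * suc (suc l) + 1
  shape = ℕSolver.solve-∀
  shift-l : ∀ l d → suc (suc l) + 2 * d ≡ l + 2 * suc d
  shift-l = ℕSolver.solve-∀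
  e′ = trans (shift-l l d) e
  l+2≤r : suc (suc l) ≤ r
  l+2≤r = subst (suc (suc l) ≤_) e′ (m≤m+n (suc (suc l)) (2 * d))

-- The end of the run is sought two levels at a time, keeping `f + 2 * j` constant. As it bounds the
-- sum of the parts, the search finds the end before `f` runs out.
good⇒stopsAt : ∀ f j {π} → sum π ≤ f + 2 * j →
  (∀ i → 1 ≤ i → i ≤ 2 * j → 2 * i ∈ π) →
  (∀ i → Odd i → i ≤ 2 * (2 * j) + 1 → i ∉ π) →
  Good f (2 * j) π → ∃ λ j → StopsAt (2 * j) π
good⇒stopsAt f j {π} size evens odds good with 2 * (2 * j) + 2 ∈? π
... | no c∉π = j , mkStopsAt evens odds (inj₁ c∉π)
... | yes c∈π with 2 * (2 * j) + 3 ∈? π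
...   | yes c+1∈π = j , mkStopsAt evens odds (inj₂ (c∈π , c+1∈π))
...   | no  c+1∉π = continue f size good
  where
  nextEven : ∀ r → (∀ i → 1 ≤ i → i ≤ r → 2 * i ∈ π) → 2 * r + 2 ∈ π →
             ∀ i → 1 ≤ i → i ≤ suc r → 2 * i ∈ π
  nextEven r h c∈ i 1≤i i≤ with m≤n⇒m<n∨m≡n i≤
  ... | inj₁ (s≤s i≤r) = h i 1≤i i≤r
  ... | inj₂ refl      = subst (_∈ π) (sym (2*-suc r)) c∈
  nextOdd : ∀ r → (∀ i → Odd i → i ≤ 2 * r + 1 → i ∉ π) → 2 * r + 3 ∉ π →
            ∀ i → Odd i → i ≤ 2 * suc r + 1 → i ∉ π
  nextOdd r h c+1∉ i odd i≤ with i ≤? 2 * r + 2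
  ... | yes i≤c = h i odd (≤2k+2⇒≤2k+1 r odd i≤c)
  ... | no  i≰c = subst (_∉ π) (≤-antisym
          (≤-trans (≤-reflexive (+-suc (2 * r) 2)) (≰⇒> i≰c)) (≤-trans i≤ (≤-reflexive (shape r)))) c+1∉
    where
    shape : ∀ r → 2 * suc r + 1 ≡ 2 * r + 3
    shape = ℕSolver.solve-∀
  continue : ∀ f → sum π ≤ f + 2 * j → Good f (2 * j) π → ∃ λ j → StopsAt (2 * j) π
  -- With `f = 0` the part 4j+2 would exceed the whole sum.
  continue zero size good = contradiction (≤-trans (∈⇒≤sum c∈π) size)
    (<⇒≱ (≤-<-trans (m≤m+n (2 * j) (2 * j + 0)) (m<m+n (2 * (2 * j)) (s≤s z≤n))))
  -- `Good 0` holds trivially, so `Bad 0` at this level is already established, against `good`.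
  continue (suc zero) size good = ⊥-elim (good (c∈π , c+1∉π , tt))
  continue (suc (suc f)) size good with bad? f (suc (2 * j)) π
  ... | no  good′ = ⊥-elim (good (c∈π , c+1∉π , good′))
  ... | yes (d∈π , d+1∉π , good′) = good⇒stopsAt f (suc j)
    (≤-trans size (≤-reflexive (shape f j)))
    (λ i 1≤i i≤ → nextEven (suc (2 * j)) (nextEven (2 * j) evens c∈π) d∈π i 1≤i
      (≤-trans i≤ (≤-reflexive (*-suc 2 j))))
    (λ i odd i≤ → nextOdd (suc (2 * j)) (nextOdd (2 * j) odds c+1∉π) d+1∉π i odd
      (≤-trans i≤ (≤-reflexive (cong (λ x → 2 * x + 1) (*-suc 2 j)))))
    (subst (λ l → Good f l π) (sym (*-suc 2 j)) good′)
    where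
    shape : ∀ f j → suc (suc f) + 2 * j ≡ f + 2 * suc j
    shape = ℕSolver.solve-∀

last≡2 : ∀ {π} → AllPairs _≥_ π → All (1 <_) π → 2 ∈ π → last π ≡ just 2
last≡2 {a ∷ []}    _                 _          (here refl) = refl
last≡2 {a ∷ b ∷ π} ((a≥b ∷ _) ∷ ps) (_ ∷ 1<s)  (here refl) with 1<b ∷ _ ← 1<s =
  last≡2 ps 1<s (here (≤-antisym 1<b a≥b))
last≡2 {a ∷ b ∷ π} (_ ∷ ps)         (_ ∷ 1<s)  (there 2∈)  = last≡2 ps 1<s 2∈

last⇒∈ : ∀ {x : ℕ} {π : List ℕ} → last π ≡ just x → x ∈ π
last⇒∈ {π = a ∷ []}    refl = here refl
last⇒∈ {π = a ∷ b ∷ π} e    = there (last⇒∈ {π = b ∷ π} e)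

4j+3 : ∀ j → 4 * suc j ∸ 1 ≡ 2 * (2 * j) + 3
4j+3 j = trans (cong (_∸ 1) (shape j)) (+-∸-assoc (2 * (2 * j)) {4} (s≤s z≤n))
  where
  shape : ∀ j → 4 * suc j ≡ 2 * (2 * j) + 4
  shape = ℕSolver.solve-∀

4j≡ : ∀ j → 4 * j ≡ 2 * (2 * j)
4j≡ = ℕSolver.solve-∀

2j+1 : ∀ j → 2 * suc j ∸ 1 ≡ suc (2 * j)
2j+1 j = cong pred (*-suc 2 j)

-- With index j+1 the even parts reach 4j+2 and the odd part present is 4j+3. The run therefore
-- counts as ending at 4j, by the second alternative of `stop`.
start₁⇒stopsAt : ∀ {j π} → Start₁ π (suc j) → StopsAt (2 * j) π
start₁⇒stopsAt {j} {π} (mkStart₁ evens once odds) = mkStopsAt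
  (λ i 1≤i i≤ → present i 1≤i (m≤n⇒m≤1+n i≤))
  (λ i odd i≤ → freq≡0⇒∉ (odds i odd (≤-trans (s≤s i≤)
    (≤-trans (≤-reflexive (sym (+-suc (2 * (2 * j)) 1)))
      (≤-trans (+-monoʳ-≤ (2 * (2 * j)) (n≤1+n 2)) (≤-reflexive (sym (4j+3 j))))))))
  (inj₂ ( subst (_∈ π) (2*-suc (2 * j)) (present (suc (2 * j)) (s≤s z≤n) ≤-refl)
        , freq>0⇒∈ _ π (≤-reflexive (sym (subst (λ x → freq x π ≡ 1) (4j+3 j) once)))))
  where
  present : ∀ i → 1 ≤ i → i ≤ suc (2 * j) → 2 * i ∈ π
  present i 1≤i i≤ = freq>0⇒∈ (2 * i) π (evens i 1≤i (≤-trans i≤ (≤-reflexive (sym (2j+1 j)))))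

start₂⇒stopsAt : ∀ {j π} → Start₂ π j → StopsAt (2 * j) π
start₂⇒stopsAt {j} {π} (mkStart₂ evens gone odds) = mkStopsAt
  (λ i 1≤i i≤ → freq>0⇒∈ (2 * i) π (evens i 1≤i i≤))
  (λ i odd i≤ → freq≡0⇒∉ (odds i odd (≤-trans i≤ (≤-reflexive (cong (_+ 1) (sym (4j≡ j)))))))
  (inj₁ (subst (λ x → x + 2 ∉ π) (4j≡ j) (freq≡0⇒∉ gone)))

stopsAt⇒start : ∀ {j π} → OddsDistinctFrom 0 π → 2 ∈ π → StopsAt (2 * j) π →
                ∃ λ j → 1 ≤ j × (Start₁ π j ⊎ Start₂ π j)
-- This would be the second kind of start with `j = 0`; it is excluded because 2 is a part.
stopsAt⇒start {zero} h 2∈π (mkStopsAt _ _ (inj₁ 2∉π)) = contradiction 2∈π 2∉π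
stopsAt⇒start {j@(suc _)} {π} h 2∈π (mkStopsAt evens odds (inj₁ c∉π)) =
  j , s≤s z≤n , inj₂ (mkStart₂
    (λ i 1≤i i≤ → ∈⇒freq>0 (evens i 1≤i i≤))
    (∉⇒freq≡0 (subst (λ x → x + 2 ∉ π) (sym (4j≡ j)) c∉π))
    (λ i odd i≤ → ∉⇒freq≡0 (odds i odd (≤-trans i≤ (≤-reflexive (cong (_+ 1) (4j≡ j)))))))
stopsAt⇒start {j} {π} h 2∈π (mkStopsAt evens odds (inj₂ (c∈π , c+1∈π))) =
  suc j , s≤s z≤n , inj₁ (mkStart₁
    (λ i 1≤i i≤ → ∈⇒freq>0 (present i 1≤i (≤-trans i≤ (≤-reflexive (2j+1 j)))))
    (subst (λ x → freq x π ≡ 1) (sym (4j+3 j))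
      (≤-antisym (proj₂ (h c+1∈π (odd-2k+3 (2 * j)))) (∈⇒freq>0 c+1∈π)))
    (λ i odd i< → ∉⇒freq≡0 (odds i odd (≤2k+2⇒≤2k+1 (2 * j) odd (s≤s⁻¹
      (≤-trans i< (≤-reflexive (trans (4j+3 j) (+-suc (2 * (2 * j)) 2)))))))))
  where
  present : ∀ i → 1 ≤ i → i ≤ suc (2 * j) → 2 * i ∈ π
  present i 1≤i i≤ with m≤n⇒m<n∨m≡n i≤
  ... | inj₁ (s≤s i≤2j) = evens i 1≤i i≤2j
  ... | inj₂ refl       = subst (_∈ π) (sym (2*-suc (2 * j))) c∈π

prdo⇒good : ∀ {π} → Prdo π → OddsDistinctFrom 0 π × Good (sum π) 0 π
prdo⇒good {π} (mkPrdo isP distinct >1 start) = odds , good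
  where
  odds : OddsDistinctFrom 0 π
  odds {x} x∈π odd = ≤∧≢⇒< (All.lookup >1 x∈π) (λ { refl → odd (m∣m*n 1) }) , distinct x odd
  fromStop : ∀ j → StopsAt (2 * j) π → Good (sum π) 0 π
  fromStop zero    s = stopsAt⇒good 0 (sum π) 0 s refl z≤n
  fromStop (suc j) s = stopsAt⇒good (suc j) (sum π) 0 s refl
    -- The last even part of the run, 2(2(j+1)), is at most the sum, so the search bound `sum π` is
    -- large enough.
    (≤-trans (m≤m+n (2 * suc j) (2 * suc j + 0)) (∈⇒≤sum (StopsAt.evens s (2 * suc j) (s≤s z≤n) ≤-refl)))
  good : Good (sum π) 0 π
  good with 2 ∈? π
  -- Without the part 2 the run is empty and stops at once.
  ... | no 2∉π = fromStop 0 (mkStopsAt (λ { zero () _ ; (suc _) _ () })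
      (λ i odd i≤1 i∈π → <⇒≱ (All.lookup >1 i∈π) i≤1) (inj₁ 2∉π))
  ... | yes 2∈π with start (last≡2 (sorted isP) >1 2∈π)
  ...   | suc j , _ , inj₁ s = fromStop j (start₁⇒stopsAt s)
  ...   | j     , _ , inj₂ s = fromStop j (start₂⇒stopsAt s)

good⇒prdo : ∀ {π} → IsPartition π → OddsDistinctFrom 0 π → Good (sum π) 0 π → Prdo π
good⇒prdo {π} isP h good = mkPrdo isP distinct >1 λ last≡2 →
  let (j , s) = good⇒stopsAt (sum π) 0 (m≤m+n (sum π) 0)
                  (λ { zero () _ ; (suc _) _ () })
                  (λ i odd i≤1 i∈π → <⇒≱ (≤-trans (n≤1+n 2) (proj₁ (h i∈π odd))) i≤1) good
  in stopsAt⇒start {j} h (last⇒∈ last≡2) s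
  where
  distinct : ∀ i → Odd i → freq i π ≤ 1
  distinct i odd with i ∈? π
  ... | yes i∈π = proj₂ (h i∈π odd)
  ... | no  i∉π = ≤-trans (≤-reflexive (∉⇒freq≡0 i∉π)) z≤n
  >1 : All (1 <_) π
  >1 = All.tabulate λ x∈π → ≤∧≢⇒< (All.lookup (IsPartition.positive isP) x∈π)
    λ { refl → <⇒≱ (s≤s (s≤s z≤n)) (proj₁ (h x∈π (from-no (2 ∣? 1)))) }

goodSeries≡Prdo : ∀ n → goodSeries n 0 n ≡ partitionSum (λ π → indicator (Prdo? π)) n
goodSeries≡Prdo n = partitionSum-cong n λ { {π} isP refl →
  indicator-cong (oddsDistinctFrom? 0 π ×-dec good? (sum π) 0 π) (Prdo? π)
    (λ (h , g) → good⇒prdo isP h g) prdo⇒good }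

-- From natural to rational coefficients

toℚ : ℕ → ℚ
toℚ n = fromℤ (ℤ.+ n)

toℚ-+ : ∀ m n → toℚ (m + n) ≡ toℚ m ℚ.+ toℚ n
toℚ-+ m n = ℚ.toℚᵘ-injective (ℚᵘ.≃-trans (*≡* (cong (ℤ._* ℤ.1ℤ) (trans (ℤ.pos-+ m n)
    (sym (cong₂ ℤ._+_ (ℤ.*-identityʳ (ℤ.+ m)) (ℤ.*-identityʳ (ℤ.+ n)))))))
  (ℚᵘ.≃-sym (ℚ.toℚᵘ-homo-+ (toℚ m) (toℚ n))))

toℚ-* : ∀ m n → toℚ (m * n) ≡ toℚ m ℚ.* toℚ n
toℚ-* m n = ℚ.toℚᵘ-injective (ℚᵘ.≃-trans (*≡* (cong (ℤ._* ℤ.1ℤ) (ℤ.pos-* m n)))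
  (ℚᵘ.≃-sym (ℚ.toℚᵘ-homo-* (toℚ m) (toℚ n))))

[2*n]/2 : ∀ n → ℤ.+ (2 * n) ℚ./ 2 ≡ toℚ n
[2*n]/2 n = trans
  (ℚ.fromℚᵘ-cong {mkℚᵘ (ℤ.+ (2 * n)) 1} {mkℚᵘ (ℤ.+ n) 0} (*≡* (trans (ℤ.*-identityʳ (ℤ.+ (2 * n)))
    (trans (cong ℤ.+_ (*-comm 2 n)) (ℤ.pos-* n 2)))))
  (ℚ.fromℚᵘ-toℚᵘ (toℚ n))

foldr-filter-toℚ : ∀ {A : Set} {P : A → Set} (P? : ∀ x → Dec (P x)) {w F} xs →
  (∀ {x} → x ∈ xs → P x → w x ≡ toℚ (F x)) → (∀ {x} → x ∈ xs → ¬ P x → F x ≡ 0) →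
  foldr ℚ._+_ 0ℚ (map w (filter P? xs)) ≡ toℚ (sum (map F xs))
foldr-filter-toℚ P? []       inside outside = refl
foldr-filter-toℚ P? {F = F} (x ∷ xs) inside outside
  with P? x | foldr-filter-toℚ P? xs (inside ∘ there) (outside ∘ there)
... | yes p | ih = trans (cong₂ ℚ._+_ (inside (here refl) p) ih) (sym (toℚ-+ (F x) _))
... | no ¬p | ih = trans ih (cong (λ z → toℚ (z + sum (map F xs))) (sym (outside (here refl) ¬p)))

-- Comparison of `ω₂` with the natural-valued weight

δₑ-even : ∀ {n} → Even n → δₑ n ≡ ℤ.+ 1
δₑ-even {n} e with 2 ∣? n
... | yes _ = refl
... | no ¬e = contradiction e ¬e

δₑ-odd : ∀ {n} → Odd n → δₑ n ≡ ℤ.+ 0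
δₑ-odd {n} o with 2 ∣? n
... | yes e = contradiction e o
... | no _  = refl

even⊎odd : ∀ n → (∃ λ k → n ≡ 2 * k) ⊎ (∃ λ k → n ≡ 2 * k + 1)
even⊎odd zero    = inj₁ (0 , refl)
even⊎odd (suc n) with even⊎odd n
... | inj₁ (k , refl) = inj₂ (k , +-comm 1 (2 * k))
... | inj₂ (k , refl) = inj₁ (suc k , sym (trans (2*-suc k) (+-suc (2 * k) 1)))

odd-2k+1 : ∀ k → Odd (2 * k + 1)
odd-2k+1 k e = from-no (2 ∣? 1) (∣m+n∣m⇒∣n e (m∣m*n k))

-- Adding `δₑ` rounds up to an odd number; in `suc-δₑ` subtracting it rounds down to one. A factor
-- of `ω₂` is thus half the difference of two odd numbers, which counts the even integers between
-- them.
n+δₑ : ∀ n → ℤ.+ n ℤ.+ δₑ n ≡ ℤ.+ (2 * ⌊ n /2⌋ + 1)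
n+δₑ n with even⊎odd n
... | inj₁ (k , refl) = trans (cong (ℤ._+_ (ℤ.+ (2 * k))) (δₑ-even (m∣m*n k)))
  (cong (λ x → ℤ.+ (2 * x + 1)) (sym (⌊2*k/2⌋ k)))
... | inj₂ (k , refl) = trans (cong (ℤ._+_ (ℤ.+ (2 * k + 1))) (δₑ-odd (odd-2k+1 k)))
  (trans (ℤ.+-identityʳ _) (cong (λ x → ℤ.+ (2 * x + 1)) (sym (⌊2*k+1/2⌋ k))))

suc-δₑ : ∀ n → ℤ.+ suc n ℤ.- δₑ (suc n) ≡ ℤ.+ (2 * ⌊ n /2⌋ + 1)
suc-δₑ n with even⊎odd n
... | inj₁ (k , refl) = trans
  (cong (λ x → ℤ.+ suc (2 * k) ℤ.- x) (δₑ-odd (subst Odd (+-comm (2 * k) 1) (odd-2k+1 k))))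
  (trans (ℤ.+-identityʳ _) (cong ℤ.+_ (trans (+-comm 1 (2 * k))
    (cong (λ x → 2 * x + 1) (sym (⌊2*k/2⌋ k))))))
... | inj₂ (k , refl) = trans (cong (λ x → ℤ.+ suc (2 * k + 1) ℤ.- x)
    (δₑ-even (subst Even (+-suc (2 * k) 1) (even-2k+2 k))))
  (cong (λ x → ℤ.+ (2 * x + 1)) (sym (⌊2*k+1/2⌋ k)))

ω₂-numerator : ∀ {a b} → b < a →
  ℤ.+ a ℤ.- ℤ.+ b ℤ.- δₑ a ℤ.- δₑ b ≡ ℤ.+ (2 * evensBetween a b)
ω₂-numerator {suc a} {b} (s≤s b≤a) = begin
  ℤ.+ suc a ℤ.- ℤ.+ b ℤ.- δₑ (suc a) ℤ.- δₑ b
    ≡⟨ regroup (ℤ.+ suc a) (ℤ.+ b) (δₑ (suc a)) (δₑ b) ⟩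
  (ℤ.+ suc a ℤ.- δₑ (suc a)) ℤ.- (ℤ.+ b ℤ.+ δₑ b)
    ≡⟨ cong₂ ℤ._-_ (suc-δₑ a) (n+δₑ b) ⟩
  ℤ.+ (2 * ⌊ a /2⌋ + 1) ℤ.- ℤ.+ (2 * ⌊ b /2⌋ + 1)
    ≡⟨ ℤ.m-n≡m⊖n (2 * ⌊ a /2⌋ + 1) (2 * ⌊ b /2⌋ + 1) ⟩
  (2 * ⌊ a /2⌋ + 1) ℤ.⊖ (2 * ⌊ b /2⌋ + 1)
    ≡⟨ ℤ.⊖-≥ (+-monoˡ-≤ 1 (*-monoʳ-≤ 2 (⌊n/2⌋-mono b≤a))) ⟩
  ℤ.+ ((2 * ⌊ a /2⌋ + 1) ∸ (2 * ⌊ b /2⌋ + 1))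
    ≡⟨ cong ℤ.+_ ([m+n]∸[o+n]≡m∸o (2 * ⌊ a /2⌋) (2 * ⌊ b /2⌋) 1) ⟩
  ℤ.+ (2 * ⌊ a /2⌋ ∸ 2 * ⌊ b /2⌋)
    ≡⟨ cong ℤ.+_ (*-distribˡ-∸ 2 ⌊ a /2⌋ ⌊ b /2⌋) ⟨
  ℤ.+ (2 * evensBetween (suc a) b) ∎
  where
  open ≡-Reasoning
  [m+n]∸[o+n]≡m∸o : ∀ m o n → (m + n) ∸ (o + n) ≡ m ∸ o
  [m+n]∸[o+n]≡m∸o m o n = trans (cong₂ _∸_ (+-comm m n) (+-comm o n)) ([m+n]∸[m+o]≡n∸o n m o)
  regroup : ∀ a b d e → a ℤ.- b ℤ.- d ℤ.- e ≡ (a ℤ.- d) ℤ.- (b ℤ.+ e)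
  regroup = ℤSolver.solve-∀

ω₂-factor : ∀ {a b} → b < a → (ℤ.+ a ℤ.- ℤ.+ b ℤ.- δₑ a ℤ.- δₑ b) ℚ./ 2 ≡ toℚ (evensBetween a b)
ω₂-factor {a} {b} b<a = trans (cong (ℚ._/ 2) (ω₂-numerator b<a)) ([2*n]/2 (evensBetween a b))

ω₂≡weight : ∀ {π} → All (3 ≤_) π → Linked (λ a b → b + 2 ≤ a) π → ω₂ π ≡ toℚ (weight 0 π)
ω₂≡weight {[]}        _          _        = refl
ω₂≡weight {a ∷ []}    (3≤a ∷ _)  _        =
  trans (cong (ℚ._* 1ℚ) (ω₂-factor (≤-trans (s≤s z≤n) 3≤a))) (ℚ.*-identityʳ _)
ω₂≡weight {a ∷ b ∷ π} (_ ∷ 3≤) (b+2≤a ∷ ds) = trans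
  (cong₂ ℚ._*_ (ω₂-factor (≤-trans (≤-trans (≤-reflexive (+-comm 1 b)) (+-monoʳ-≤ b (s≤s z≤n))) b+2≤a))
    (ω₂≡weight {b ∷ π} 3≤ ds))
  (sym (toℚ-* (evensBetween a b) (weight 0 (b ∷ π))))

evensBetween≢0⇒b+2≤a : ∀ {a b} → evensBetween a b ≢ 0 → b + 2 ≤ a
evensBetween≢0⇒b+2≤a {a} {b} h with b + 2 ≤? a
... | yes le = le
... | no ≰  = contradiction (m≤n⇒m∸n≡0 (⌊n/2⌋-mono (a∸1≤ a (≰⇒> ≰)))) h
  where
  a∸1≤ : ∀ a → a < b + 2 → a ∸ 1 ≤ b
  a∸1≤ zero    _  = z≤n
  a∸1≤ (suc a) lt = s≤s⁻¹ (s≤s⁻¹ (≤-trans lt (≤-reflexive (+-comm b 2))))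

evensBetween-consecutive : ∀ {b} k → 2 * k ≤ b → evensBetween (2 * k + 2) b ≡ 0
evensBetween-consecutive {b} k 2k≤b = m≤n⇒m∸n≡0 (≤-trans
  (≤-reflexive (trans (cong ⌊_/2⌋ (+-∸-assoc (2 * k) {2} (s≤s z≤n)))
    (trans (⌊2*k+1/2⌋ k) (sym (⌊2*k/2⌋ k)))))
  (⌊n/2⌋-mono 2k≤b))

NoConsecutiveEvens : List ℕ → Set
NoConsecutiveEvens π = ∀ k → ¬ (2 * k ∈ π × 2 * k + 2 ∈ π)

2k≢2k+2 : ∀ k → 2 * k ≢ 2 * k + 2
2k≢2k+2 k e = <⇒≢ (m<m+n (2 * k) (s≤s z≤n)) e

-- A nonzero product has no zero factor. The last factor requires an even integer strictly between 0
-- and the last part; each other factor requires one strictly between two consecutive parts, which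
-- forces a gap of at least 2 and rules out 2k next to 2k+2.
weight≢0⇒GG₂ : ∀ {π} → AllPairs _≥_ π → weight 0 π ≢ 0 →
  All (3 ≤_) π × Linked (λ a b → b + 2 ≤ a) π × NoConsecutiveEvens π
weight≢0⇒GG₂ {[]}     _ _ = [] , [] , λ { _ (() , _) }
weight≢0⇒GG₂ {a ∷ []} _ h = 3≤ a h ∷ [] , [-]
  , λ { k (here e , here e′) → 2k≢2k+2 k (trans e (sym e′)) }
  where
  3≤ : ∀ a → evensBetween a 0 ≢ 0 → 3 ≤ a
  3≤ 0                   h = contradiction refl h
  3≤ 1                   h = contradiction refl h
  3≤ 2                   h = contradiction refl h
  3≤ (suc (suc (suc a))) h = s≤s (s≤s (s≤s z≤n))
weight≢0⇒GG₂ {a ∷ b ∷ π} (a≥ ∷ ps@(b≥ ∷ _)) h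
  with ge3 , ds , evens ← weight≢0⇒GG₂ ps (λ e → h
    (trans (cong (evensBetween a b *_) e) (*-zeroʳ (evensBetween a b)))) =
  ≤-trans (All.head ge3) (≤-trans (m≤m+n b 2) b+2≤a) ∷ ge3 , b+2≤a ∷ ds , noConsecutive
  where
  factor≢0 : evensBetween a b ≢ 0
  factor≢0 e = h (cong (_* weight 0 (b ∷ π)) e)
  b+2≤a = evensBetween≢0⇒b+2≤a factor≢0
  tail≤b : ∀ {x} → x ∈ b ∷ π → x ≤ b
  tail≤b (here refl) = ≤-refl
  tail≤b (there x∈π) = All.lookup b≥ x∈π
  noConsecutive : NoConsecutiveEvens (a ∷ b ∷ π)
  noConsecutive k (here e , here e′)       = 2k≢2k+2 k (trans e (sym e′))
  -- If 2k occurs below the head 2k+2, then `b` is at least 2k and no even integer lies strictly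
  -- between `b` and the head.
  noConsecutive k (there 2k∈ , here refl)  = factor≢0 (evensBetween-consecutive k (tail≤b 2k∈))
  noConsecutive k (here refl , there 2k+2∈) = <⇒≱ (m<m+n (2 * k) (s≤s z≤n)) (All.lookup a≥ 2k+2∈)
  noConsecutive k (there p , there q)      = evens k (p , q)

¬GG₂⇒weight≡0 : ∀ {π} → IsPartition π → ¬ GG₂ π → weight 0 π ≡ 0
¬GG₂⇒weight≡0 {π} isP ¬gg with weight 0 π ≟ 0
... | yes e = e
... | no ≢0 = let (ge3 , ds , evens) = weight≢0⇒GG₂ (sorted isP) ≢0 in
  contradiction (mkGG₂ isP ge3 ds evens) ¬gg

generatingFunction-GG₂ : ∀ n → generatingFunction GG₂? ω₂ n ≡ toℚ (sum (map (weight 0) (partitions n)))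
generatingFunction-GG₂ n = foldr-filter-toℚ GG₂? (partitions n)
  (λ _ gg → ω₂≡weight (GG₂.partsAtLeast3 gg) (GG₂.differences gg))
  (λ {π} p → ¬GG₂⇒weight≡0 (proj₁ (∈-partitions⁻ {π} {n} p)))

generatingFunction-count : ∀ {P : List ℕ → Set} (P? : ∀ π → Dec (P π)) n →
  generatingFunction P? (λ _ → 1ℚ) n ≡ toℚ (sum (map (indicator ∘ P?) (partitions n)))
generatingFunction-count P? n = foldr-filter-toℚ P? (partitions n)
  (λ {π} _ p → cong toℚ (sym (indicator-yes (P? π) p)))
  (λ {π} _ → indicator-no (P? π))

theorem3p5 : generatingFunction GG₂? ω₂ ≗ generatingFunction Prdo? (λ _ → 1ℚ)
theorem3p5 n = trans (generatingFunction-GG₂ n) (trans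
  (cong toℚ (ℤ.+-injective (trans (weightSeries≡goodSeries n) (goodSeries≡Prdo n))))
  (sym (generatingFunction-count Prdo? n)))
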